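{- Let $\alpha,\beta$ be fixed nonzero real numbers. There exist constants $C,N>0$, independent of $n$, $\epsilon$ and the point set, such that the following holds: for every $n>N$, every $\epsilon>0$, and every set $P\subset[0,1]^2$ of $n$ points satisfying the separation condition $$\min\{|p-q|:\ p,q\in P,\ p\neq q\}\ge \epsilon,$$ we have $$|\Pi_{\alpha,\beta}(P)|\le C\, n^{4/3}\,\epsilon^{ -1}\log(\epsilon^{ -1}).$$
   Context: For a finite set $P\subset\mathbb R^2$ and real numbers $\alpha,\beta$, define the set of ordered triples $$\Pi_{\alpha,\beta}(P)=\{(p,q,r)\in P\times P\times P:\ p\cdot q=\alpha \text{ and } p\cdot r=\beta\},$$ where $\cdot$ is the standard dot product on $\mathbb R^2$ (the points $p,q,r$ need not be distinct). Here $|p-q|$ is the Euclidean distance. -}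

module Defs where

open import Level using (0ℓ)
open import Algebra.Apartness.Bundles using (HeytingField; HeytingCommutativeRing)
open import Algebra.Bundles using (CommutativeRing; RawRing)
open import Data.Fin.Base using (Fin)
open import Data.Maybe.Base as Maybe using (Maybe; just; nothing)
open import Data.Nat.Base as ℕ using (ℕ)
import Data.Nat.Properties as ℕ
open import Data.Product.Base using (Σ; ∃; ∃-syntax; _×_; _,_; proj₁; proj₂)
open import Data.Product.Relation.Binary.Pointwise.NonDependent using (×-setoid)
open import Data.Sum.Base using (_⊎_; inj₁; inj₂; [_,_]′)
open import Function.Base using (_∘_)
open import Function.Bundles using (Injection; Inverse)
open import Relation.Binary.Bundles using (Setoid)
open import Relation.Binary.Core using (Rel)
open import Relation.Binary.Definitions using (Cotransitive)
open import Relation.Binary.PropositionalEquality as ≡ using (_≡_)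
open import Relation.Binary.Structures using (IsStrictPartialOrder)
open import Relation.Nullary using (¬_; yes; no; contradiction)
open import Relation.Unary using (Pred)
import Algebra.Apartness.Properties.HeytingCommutativeRing
import Algebra.Properties.AbelianGroup
import Algebra.Properties.CommutativeSemiring.Exp
import Algebra.Properties.Ring
import Algebra.Properties.Semiring.Exp
import Algebra.Properties.Semiring.Mult
import Algebra.Solver.Ring
import Algebra.Solver.Ring.AlmostCommutativeRing as ACR
import Relation.Binary.Construct.On as On
import Relation.Binary.Reasoning.Setoid

-- Fields with a cotransitive strict order whose induced apartness is that of the
-- field.  The non-strict order is the negation of the converse strict one.
record OrderedField : Set₁ where
  field
    heytingField : HeytingField 0ℓ 0ℓ 0ℓ

  open HeytingField heytingField public

  infix 4 _<_

  field
    _<_                    : Rel Carrier 0ℓ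
    <-isStrictPartialOrder : IsStrictPartialOrder _≈_ _<_
    <-cotrans              : Cotransitive _<_
    #⇒<⊎>                  : ∀ {x y} → x # y → x < y ⊎ y < x
    <⇒#                    : ∀ {x y} → x < y → x # y
    +-monoˡ-<              : ∀ z {x y} → x < y → x + z < y + z
    *-pos                  : ∀ {x y} → 0# < x → 0# < y → 0# < x * y

  infix 4 _≤_ _≉_

  _≤_ : Rel Carrier 0ℓ
  x ≤ y = ¬ (y < x)

  _≉_ : Rel Carrier 0ℓ
  x ≉ y = ¬ (x ≈ y)

  commutativeRing : CommutativeRing 0ℓ 0ℓ
  commutativeRing = HeytingCommutativeRing.commutativeRing heytingCommutativeRing

  open CommutativeRing commutativeRing public using (semiring)
  open Algebra.Properties.Semiring.Exp semiring public using (_^_)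

  fromℕ : ℕ → Carrier
  fromℕ n = Algebra.Properties.Semiring.Mult._×_ semiring n 1#

  IsUpperBound : Pred Carrier 0ℓ → Carrier → Set
  IsUpperBound A u = ∀ {a} → A a → a ≤ u

  IsSupremum : Pred Carrier 0ℓ → Carrier → Set
  IsSupremum A s = IsUpperBound A s × (∀ {x} → x < s → ∃[ a ] A a × x < a)

  IsLocated : Pred Carrier 0ℓ → Set
  IsLocated A = ∀ {x y} → x < y → (∃[ a ] A a × x < a) ⊎ IsUpperBound A y

-- The real numbers, as a Dedekind-complete Archimedean ordered field.  Suprema are
-- required only of order-located sets: these axioms hold constructively for the
-- Cauchy reals, and under excluded middle, where every set is located, they are the
-- usual axioms of a complete ordered field.
record Reals : Set₁ where
  field
    orderedField : OrderedField

  open OrderedField orderedField public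

  field
    archimedean : ∀ x → ∃[ n ] x < fromℕ n
    supremum    : (A : Pred Carrier 0ℓ) → ∃ A → ∃ (IsUpperBound A) → IsLocated A →
                  ∃ (IsSupremum A)

module OrderedFieldProperties (F : OrderedField) where

  open OrderedField F
  open CommutativeRing commutativeRing using (ring; +-abelianGroup)
  open Algebra.Properties.AbelianGroup +-abelianGroup using (⁻¹-anti-homo‿-)
  open Algebra.Properties.Ring ring using (//-rightDividesʳ; x[y-z]≈xy-xz; [y-z]x≈yx-zx; -0#≈0#)
  open Algebra.Properties.Semiring.Mult semiring using (×-homo-+; ×1-homo-*)
  private module HCR = Algebra.Apartness.Properties.HeytingCommutativeRing heytingCommutativeRing
  open IsStrictPartialOrder <-isStrictPartialOrder public
    using () renaming (irrefl to <-irrefl; trans to <-trans; asym to <-asym;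
                       <-respˡ-≈ to <-respˡ; <-respʳ-≈ to <-respʳ)

  -- A ring solver whose coefficients are formal differences of naturals, because
  -- equality of reals is undecidable.
  module Solver where

    private
      open Relation.Binary.Reasoning.Setoid setoid

      differences : RawRing 0ℓ 0ℓ
      differences = record
        { Carrier = ℕ × ℕ
        ; _≈_     = _≡_
        ; _+_     = λ (a , b) (c , d) → a ℕ.+ c , b ℕ.+ d
        ; _*_     = λ (a , b) (c , d) → a ℕ.* c ℕ.+ b ℕ.* d , a ℕ.* d ℕ.+ b ℕ.* c
        ; -_      = λ (a , b) → b , a
        ; 0#      = 0 , 0
        ; 1#      = 1 , 0
        }

      open RawRing differences using () renaming (_+_ to _+ᵈ_; _*_ to _*ᵈ_)

      ring′ : ACR.AlmostCommutativeRing 0ℓ 0ℓ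
      ring′ = ACR.fromCommutativeRing commutativeRing

      module Weak = Algebra.Solver.Ring _ ring′ (ACR.-raw-almostCommutative⟶ ring′) (λ _ _ → nothing)

      diff : ℕ × ℕ → Carrier
      diff (a , b) = fromℕ a - fromℕ b

      -- Agrees with diff, but makes the constant one evaluate to 1# definitionally.
      ⟦_⟧ : ℕ × ℕ → Carrier
      ⟦ 1 , 0 ⟧ = 1#
      ⟦ x     ⟧ = diff x

      ⟦_⟧-diff : ∀ x → ⟦ x ⟧ ≈ diff x
      ⟦ 0 , 0 ⟧-diff = refl
      ⟦ 1 , 0 ⟧-diff = sym (trans (+-cong (+-identityʳ 1#) -0#≈0#) (+-identityʳ 1#))
      ⟦ ℕ.suc (ℕ.suc _) , 0 ⟧-diff = refl
      ⟦ 0 , ℕ.suc _ ⟧-diff = refl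
      ⟦ 1 , ℕ.suc _ ⟧-diff = refl
      ⟦ ℕ.suc (ℕ.suc _) , ℕ.suc _ ⟧-diff = refl

      +-homo : ∀ x y → diff (x +ᵈ y) ≈ diff x + diff y
      +-homo (a , b) (c , d) = begin
        fromℕ (a ℕ.+ c) - fromℕ (b ℕ.+ d)
          ≈⟨ +-cong (×-homo-+ 1# a c) (-‿cong (×-homo-+ 1# b d)) ⟩
        (fromℕ a + fromℕ c) - (fromℕ b + fromℕ d)
          ≈⟨ solve 4 (λ a b c d → (a :+ c) :- (b :+ d) := (a :- b) :+ (c :- d))
               refl (fromℕ a) (fromℕ b) (fromℕ c) (fromℕ d) ⟩
        diff (a , b) + diff (c , d) ∎
        where open Weak using (solve; _:=_; _:+_; _:-_)

      *-homo : ∀ x y → diff (x *ᵈ y) ≈ diff x * diff y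
      *-homo (a , b) (c , d) = begin
        fromℕ (a ℕ.* c ℕ.+ b ℕ.* d) - fromℕ (a ℕ.* d ℕ.+ b ℕ.* c)
          ≈⟨ +-cong (dot a c b d) (-‿cong (dot a d b c)) ⟩
        (fromℕ a * fromℕ c + fromℕ b * fromℕ d) - (fromℕ a * fromℕ d + fromℕ b * fromℕ c)
          ≈⟨ solve 4 (λ u v w z → (u :+ v) :- (w :+ z) := (u :- w) :+ (v :- z)) refl
               (fromℕ a * fromℕ c) (fromℕ b * fromℕ d) (fromℕ a * fromℕ d) (fromℕ b * fromℕ c) ⟩
        (fromℕ a * fromℕ c - fromℕ a * fromℕ d) + (fromℕ b * fromℕ d - fromℕ b * fromℕ c)
          ≈⟨ +-congˡ (⁻¹-anti-homo‿- (fromℕ b * fromℕ c) (fromℕ b * fromℕ d)) ⟨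
        (fromℕ a * fromℕ c - fromℕ a * fromℕ d) - (fromℕ b * fromℕ c - fromℕ b * fromℕ d)
          ≈⟨ +-cong (x[y-z]≈xy-xz (fromℕ a) (fromℕ c) (fromℕ d))
               (-‿cong (x[y-z]≈xy-xz (fromℕ b) (fromℕ c) (fromℕ d))) ⟨
        fromℕ a * (fromℕ c - fromℕ d) - fromℕ b * (fromℕ c - fromℕ d)
          ≈⟨ [y-z]x≈yx-zx (fromℕ c - fromℕ d) (fromℕ a) (fromℕ b) ⟨
        diff (a , b) * diff (c , d) ∎
        where
        open Weak using (solve; _:=_; _:+_; _:-_)
        dot : ∀ m n o p → fromℕ (m ℕ.* n ℕ.+ o ℕ.* p) ≈ fromℕ m * fromℕ n + fromℕ o * fromℕ p
        dot m n o p = trans (×-homo-+ 1# (m ℕ.* n) (o ℕ.* p)) (+-cong (×1-homo-* m n) (×1-homo-* o p))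

      -‿homo : ∀ x → diff (RawRing.-_ differences x) ≈ - diff x
      -‿homo (a , b) = sym (⁻¹-anti-homo‿- (fromℕ a) (fromℕ b))

      morphism : differences ACR.-Raw-AlmostCommutative⟶ ring′
      morphism = record
        { ⟦_⟧    = ⟦_⟧
        ; +-homo = λ x y → trans ⟦ x +ᵈ y ⟧-diff
                     (trans (+-homo x y) (sym (+-cong ⟦ x ⟧-diff ⟦ y ⟧-diff)))
        ; *-homo = λ x y → trans ⟦ x *ᵈ y ⟧-diff
                     (trans (*-homo x y) (sym (*-cong ⟦ x ⟧-diff ⟦ y ⟧-diff)))
        ; -‿homo = λ x → trans ⟦ RawRing.-_ differences x ⟧-diff
                     (trans (-‿homo x) (sym (-‿cong ⟦ x ⟧-diff)))
        ; 0-homo = -‿inverseʳ 0#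
        ; 1-homo = refl
        }

      diff≟ : ∀ x y → Maybe (diff x ≈ diff y)
      diff≟ (a , b) (c , d) with a ℕ.+ d ℕ.≟ c ℕ.+ b
      ... | no  _ = nothing
      ... | yes e = just (begin
        fromℕ a - fromℕ b
          ≈⟨ +-congʳ (//-rightDividesʳ (fromℕ d) (fromℕ a)) ⟨
        (fromℕ a + fromℕ d - fromℕ d) - fromℕ b
          ≈⟨ +-congʳ (+-congʳ (×-homo-+ 1# a d)) ⟨
        (fromℕ (a ℕ.+ d) - fromℕ d) - fromℕ b
          ≡⟨ ≡.cong (λ m → (fromℕ m - fromℕ d) - fromℕ b) e ⟩
        (fromℕ (c ℕ.+ b) - fromℕ d) - fromℕ b
          ≈⟨ solve 3 (λ x d b → (x :- d) :- b := (x :- b) :- d) refl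
               (fromℕ (c ℕ.+ b)) (fromℕ d) (fromℕ b) ⟩
        (fromℕ (c ℕ.+ b) - fromℕ b) - fromℕ d
          ≈⟨ +-congʳ (+-congʳ (×-homo-+ 1# c b)) ⟩
        (fromℕ c + fromℕ b - fromℕ b) - fromℕ d
          ≈⟨ +-congʳ (//-rightDividesʳ (fromℕ b) (fromℕ c)) ⟩
        fromℕ c - fromℕ d ∎)
        where open Weak using (solve; _:=_; _:-_)

      ⟦⟧≟ : ∀ x y → Maybe (⟦ x ⟧ ≈ ⟦ y ⟧)
      ⟦⟧≟ x y = Maybe.map
        (λ e → trans ⟦ x ⟧-diff (trans e (sym ⟦ y ⟧-diff))) (diff≟ x y)

    open Algebra.Solver.Ring differences ring′ morphism ⟦⟧≟ public

    :1 : ∀ {n} → Polynomial n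
    :1 = con (1 , 0)

  open Solver using (solve; _:=_; _:+_; _:*_; _:-_; :-_; :1)

  ≤-refl : ∀ {x} → x ≤ x
  ≤-refl = <-irrefl refl

  ≤-reflexive : ∀ {x y} → x ≈ y → x ≤ y
  ≤-reflexive x≈y y<x = <-irrefl (sym x≈y) y<x

  <⇒≤ : ∀ {x y} → x < y → x ≤ y
  <⇒≤ = <-asym

  <-≤-trans : ∀ {x y z} → x < y → y ≤ z → x < z
  <-≤-trans {z = z} x<y y≤z with <-cotrans x<y z
  ... | inj₁ x<z = x<z
  ... | inj₂ z<y = contradiction z<y y≤z

  ≤-<-trans : ∀ {x y z} → x ≤ y → y < z → x < z
  ≤-<-trans {x} x≤y y<z with <-cotrans y<z x
  ... | inj₁ y<x = contradiction y<x x≤y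
  ... | inj₂ x<z = x<z

  ≤-trans : ∀ {x y z} → x ≤ y → y ≤ z → x ≤ z
  ≤-trans x≤y y≤z z<x = x≤y (≤-<-trans y≤z z<x)

  ≤-antisym : ∀ {x y} → x ≤ y → y ≤ x → x ≈ y
  ≤-antisym {x} {y} x≤y y≤x = proj₁ (tight x y) ([ y≤x , x≤y ]′ ∘ #⇒<⊎>)

  ≤-respˡ : ∀ {x y z} → x ≈ y → x ≤ z → y ≤ z
  ≤-respˡ x≈y x≤z z<y = x≤z (<-respʳ (sym x≈y) z<y)

  ≤-respʳ : ∀ {x y z} → x ≈ y → z ≤ x → z ≤ y
  ≤-respʳ x≈y z≤x y<z = z≤x (<-respˡ (sym x≈y) y<z)

  +-cancel-< : ∀ z {x y} → x + z < y + z → x < y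
  +-cancel-< z {x} {y} =
    <-respʳ (cancel y z) ∘ <-respˡ (cancel x z) ∘ +-monoˡ-< (- z)
    where
    cancel : ∀ x z → (x + z) - z ≈ x
    cancel = solve 2 (λ x z → (x :+ z) :- z := x) refl

  +-monoʳ-< : ∀ z {x y} → x < y → z + x < z + y
  +-monoʳ-< z = <-respʳ (+-comm _ z) ∘ <-respˡ (+-comm _ z) ∘ +-monoˡ-< z

  +-mono-< : ∀ {x y u v} → x < y → u < v → x + u < y + v
  +-mono-< {y = y} {u} x<y u<v = <-trans (+-monoˡ-< u x<y) (+-monoʳ-< y u<v)

  +-monoˡ-≤ : ∀ z {x y} → x ≤ y → x + z ≤ y + z
  +-monoˡ-≤ z x≤y = x≤y ∘ +-cancel-< z

  +-monoʳ-≤ : ∀ z {x y} → x ≤ y → z + x ≤ z + y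
  +-monoʳ-≤ z = ≤-respʳ (+-comm _ z) ∘ ≤-respˡ (+-comm _ z) ∘ +-monoˡ-≤ z

  +-mono-≤ : ∀ {x y u v} → x ≤ y → u ≤ v → x + u ≤ y + v
  +-mono-≤ {y = y} {u} x≤y u≤v = ≤-trans (+-monoˡ-≤ u x≤y) (+-monoʳ-≤ y u≤v)

  <⇒0<- : ∀ {x y} → x < y → 0# < y - x
  <⇒0<- {x} = <-respˡ (-‿inverseʳ x) ∘ +-monoˡ-< (- x)

  0<-⇒< : ∀ {x y} → 0# < y - x → x < y
  0<-⇒< {x} {y} = <-respʳ (solve 2 (λ x y → (y :- x) :+ x := y) refl x y) ∘
                  <-respˡ (+-identityˡ x) ∘ +-monoˡ-< x

  neg-anti-< : ∀ {x y} → x < y → - y < - x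
  neg-anti-< {x} {y} = 0<-⇒< ∘
    <-respʳ (solve 2 (λ x y → y :- x := (:- x) :- (:- y)) refl x y) ∘ <⇒0<-

  *-monoˡ-< : ∀ {z x y} → 0# < z → x < y → x * z < y * z
  *-monoˡ-< {z} {x} {y} 0<z x<y = 0<-⇒<
    (<-respʳ ([y-z]x≈yx-zx z y x) (*-pos (<⇒0<- x<y) 0<z))

  *-monoʳ-< : ∀ {z x y} → 0# < z → x < y → z * x < z * y
  *-monoʳ-< {z} 0<z = <-respʳ (*-comm _ z) ∘ <-respˡ (*-comm _ z) ∘ *-monoˡ-< 0<z

  square-nonneg : ∀ x → 0# ≤ x * x
  square-nonneg x xx<0 = <-irrefl xx≈0 xx<0
    where
    x≈0 : x ≈ 0#
    x≈0 = ≤-antisym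
      (λ 0<x → <-asym xx<0 (*-pos 0<x 0<x))
      (λ x<0 → let 0<-x = <-respˡ -0#≈0# (neg-anti-< x<0) in
        <-asym xx<0 (<-respʳ (solve 1 (λ x → (:- x) :* (:- x) := x :* x) refl x)
                             (*-pos 0<-x 0<-x)))

    xx≈0 : x * x ≈ 0#
    xx≈0 = trans (*-cong x≈0 refl) (zeroˡ x)

  0<1 : 0# < 1#
  0<1 with #⇒<⊎> (HCR.1#0)
  ... | inj₁ 1<0 = contradiction (<-respˡ (sym (*-identityʳ 1#)) 1<0) (square-nonneg 1#)
  ... | inj₂ 0<1 = 0<1

  infix 9 _⁻¹⟨_⟩

  _⁻¹⟨_⟩ : ∀ x → 0# < x → Carrier
  x ⁻¹⟨ 0<x ⟩ = proj₁ (#⇒invertible (#-sym (<⇒# 0<x)))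

  ⁻¹-inverseˡ : ∀ {x} (0<x : 0# < x) → x ⁻¹⟨ 0<x ⟩ * x ≈ 1#
  ⁻¹-inverseˡ {x} 0<x = trans (*-cong refl (sym (HCR.x-0≈x x)))
    (proj₁ (proj₂ (#⇒invertible (#-sym (<⇒# 0<x)))))

  ⁻¹-inverseʳ : ∀ {x} (0<x : 0# < x) → x * x ⁻¹⟨ 0<x ⟩ ≈ 1#
  ⁻¹-inverseʳ 0<x = trans (*-comm _ _) (⁻¹-inverseˡ 0<x)

  ⁻¹-pos : ∀ {x} (0<x : 0# < x) → 0# < x ⁻¹⟨ 0<x ⟩
  ⁻¹-pos {x} 0<x with #⇒<⊎> (HCR.invertibleʳ⇒# (x , inv))
    where
    inv : (x ⁻¹⟨ 0<x ⟩ - 0#) * x ≈ 1#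
    inv = trans (*-cong (HCR.x-0≈x _) refl) (⁻¹-inverseˡ 0<x)
  ... | inj₂ 0<x⁻¹ = 0<x⁻¹
  ... | inj₁ x⁻¹<0 = contradiction
    (<-respˡ (⁻¹-inverseˡ 0<x) (<-respʳ (zeroˡ x) (*-monoˡ-< 0<x x⁻¹<0))) (<-asym 0<1)

  *-cancelˡ-< : ∀ {z x y} → 0# < z → z * x < z * y → x < y
  *-cancelˡ-< {z} {x} {y} 0<z =
    <-respʳ (cancel y) ∘ <-respˡ (cancel x) ∘ *-monoʳ-< (⁻¹-pos 0<z)
    where
    cancel : ∀ x → z ⁻¹⟨ 0<z ⟩ * (z * x) ≈ x
    cancel x = trans (sym (*-assoc _ z x)) (trans (*-cong (⁻¹-inverseˡ 0<z) refl) (*-identityˡ x))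

  *-cancelʳ-< : ∀ {z x y} → 0# < z → x * z < y * z → x < y
  *-cancelʳ-< 0<z = *-cancelˡ-< 0<z ∘ <-respʳ (*-comm _ _) ∘ <-respˡ (*-comm _ _)

  *-monoˡ-≤ : ∀ {z x y} → 0# ≤ z → x ≤ y → x * z ≤ y * z
  *-monoˡ-≤ {z} {x} {y} 0≤z x≤y yz<xz = <-irrefl (trans (z≈0⇒ y) (sym (z≈0⇒ x))) yz<xz
    where
    z≈0⇒ : ∀ x → x * z ≈ 0#
    z≈0⇒ x = trans (*-cong refl (≤-antisym (λ 0<z → x≤y (*-cancelʳ-< 0<z yz<xz)) 0≤z)) (zeroʳ x)

  *-monoʳ-≤ : ∀ {z x y} → 0# ≤ z → x ≤ y → z * x ≤ z * y
  *-monoʳ-≤ {z} 0≤z = ≤-respʳ (*-comm _ z) ∘ ≤-respˡ (*-comm _ z) ∘ *-monoˡ-≤ 0≤z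

  *-nonneg : ∀ {x y} → 0# ≤ x → 0# ≤ y → 0# ≤ x * y
  *-nonneg {x} {y} 0≤x 0≤y = ≤-respˡ (zeroˡ y) (*-monoˡ-≤ 0≤y 0≤x)

  +-nonneg : ∀ {x y} → 0# ≤ x → 0# ≤ y → 0# ≤ x + y
  +-nonneg 0≤x 0≤y = ≤-respˡ (+-identityˡ 0#) (+-mono-≤ 0≤x 0≤y)

  x<1+x : ∀ x → x < 1# + x
  x<1+x x = <-respˡ (+-identityˡ x) (+-monoˡ-< x 0<1)

  fromℕ-nonneg : ∀ n → 0# ≤ fromℕ n
  fromℕ-nonneg ℕ.zero    = ≤-refl
  fromℕ-nonneg (ℕ.suc n) = +-nonneg (<⇒≤ 0<1) (fromℕ-nonneg n)

  fromℕ-pos : ∀ n → 0# < fromℕ (ℕ.suc n)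
  fromℕ-pos n = ≤-<-trans (fromℕ-nonneg n) (x<1+x (fromℕ n))

  dense : ∀ {x y} → x < y → ∃[ m ] x < m × m < y
  dense {x} {y} x<y = h * (x + y) ,
    <-respˡ (halve x) (*-monoʳ-< (⁻¹-pos 0<2) (+-monoʳ-< x x<y)) ,
    <-respʳ (halve y) (*-monoʳ-< (⁻¹-pos 0<2) (+-monoˡ-< y x<y))
    where
    0<2 : 0# < 1# + 1#
    0<2 = <-trans 0<1 (x<1+x 1#)

    h = (1# + 1#) ⁻¹⟨ 0<2 ⟩

    halve : ∀ x → h * (x + x) ≈ x
    halve x = trans (solve 2 (λ h x → h :* (x :+ x) := (h :* (:1 :+ :1)) :* x) refl h x)
      (trans (*-cong (⁻¹-inverseˡ 0<2) refl) (*-identityˡ x))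

  ^-pos : ∀ {x} n → 0# < x → 0# < x ^ n
  ^-pos ℕ.zero    0<x = 0<1
  ^-pos (ℕ.suc n) 0<x = *-pos 0<x (^-pos n 0<x)

  ^-nonneg : ∀ {x} n → 0# ≤ x → 0# ≤ x ^ n
  ^-nonneg ℕ.zero    0≤x = <⇒≤ 0<1
  ^-nonneg (ℕ.suc n) 0≤x = *-nonneg 0≤x (^-nonneg n 0≤x)

  ^-mono-≤ : ∀ {x y} n → 0# ≤ x → x ≤ y → x ^ n ≤ y ^ n
  ^-mono-≤ ℕ.zero    0≤x x≤y = ≤-refl
  ^-mono-≤ (ℕ.suc n) 0≤x x≤y = ≤-trans
    (*-monoˡ-≤ (^-nonneg n 0≤x) x≤y) (*-monoʳ-≤ (≤-trans 0≤x x≤y) (^-mono-≤ n 0≤x x≤y))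

  ^-mono-< : ∀ {x y} n .{{_ : ℕ.NonZero n}} → 0# ≤ x → x < y → x ^ n < y ^ n
  ^-mono-< (ℕ.suc n) 0≤x x<y = ≤-<-trans
    (*-monoʳ-≤ 0≤x (^-mono-≤ n 0≤x (<⇒≤ x<y)))
    (*-monoˡ-< (^-pos n (≤-<-trans 0≤x x<y)) x<y)

  1^n≈1 : ∀ n → 1# ^ n ≈ 1#
  1^n≈1 ℕ.zero    = refl
  1^n≈1 (ℕ.suc n) = trans (*-identityˡ _) (1^n≈1 n)

  bernoulli : ∀ {t} n → 0# ≤ 1# + t → 1# + fromℕ n * t ≤ (1# + t) ^ n
  bernoulli {t} ℕ.zero    0≤1+t =
    ≤-reflexive (trans (+-congˡ (zeroˡ t)) (+-identityʳ 1#))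
  bernoulli {t} (ℕ.suc n) 0≤1+t = ≤-trans
    (≤-respˡ (+-identityʳ _) (≤-respʳ
      (solve 2 (λ m t → (:1 :+ (:1 :+ m) :* t) :+ m :* (t :* t) := (:1 :+ t) :* (:1 :+ m :* t))
        refl (fromℕ n) t)
      (+-monoʳ-≤ _ (*-nonneg (fromℕ-nonneg n) (square-nonneg t)))))
    (*-monoʳ-≤ 0≤1+t (bernoulli n 0≤1+t))

module RealFunctions (R : Reals) where

  open Reals R
  open OrderedFieldProperties orderedField
  open Solver using (solve; _:=_; _:+_; _:*_; _:-_; :-_; :1)
  open CommutativeRing commutativeRing using (ring; commutativeSemiring)
  open Algebra.Properties.Ring ring using (-0#≈0#)
  open Algebra.Properties.Semiring.Exp semiring using (^-congˡ; ^-congʳ; ^-assocʳ)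
  open Algebra.Properties.CommutativeSemiring.Exp commutativeSemiring using (^-distrib-*)

  RootSet : ℕ → Carrier → Pred Carrier 0ℓ
  RootSet k x y = 0# ≤ y × y ^ k ≤ x

  root-supremum : ∀ k .{{_ : ℕ.NonZero k}} {x} → 0# ≤ x → ∃ (IsSupremum (RootSet k x))
  root-supremum k@(ℕ.suc k-1) {x} 0≤x = supremum (RootSet k x) (0# , zero∈) (1# + x , bounded) located
    where
    zero∈ : RootSet k x 0#
    zero∈ = ≤-refl , ≤-respˡ (sym (zeroˡ _)) 0≤x

    bounded : IsUpperBound (RootSet k x) (1# + x)
    bounded {y} (_ , y^k≤x) 1+x<y = y^k≤x
      (<-≤-trans (x<1+x x) (≤-trans (<⇒≤ 1+x<y) (≤-respˡ (*-identityʳ y)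
        (*-monoʳ-≤ (<⇒≤ (<-trans 0<1 1<y)) (≤-respˡ (1^n≈1 k-1)
          (^-mono-≤ k-1 (<⇒≤ 0<1) (<⇒≤ 1<y)))))))
      where
      1<y : 1# < y
      1<y = ≤-<-trans (≤-respˡ (+-identityʳ 1#) (+-monoʳ-≤ 1# 0≤x)) 1+x<y

    located : IsLocated (RootSet k x)
    located {s} {t} s<t =
      let u , s<u , u<t = dense s<t in
      [ (λ s<0 → inj₁ (0# , zero∈ , s<0))
      , (λ 0<u →
          [ (λ u^k<x → inj₁ (u , (<⇒≤ 0<u , <⇒≤ u^k<x) , s<u))
          , (λ x<t^k → inj₂ λ {_} (_ , y^k≤x) t<y →
              y^k≤x (<-trans x<t^k (^-mono-< k (<⇒≤ (<-trans 0<u u<t)) t<y)))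
          ]′ (<-cotrans (^-mono-< k (<⇒≤ 0<u) u<t) x))
      ]′ (<-cotrans s<u 0#)

  root : ∀ k .{{_ : ℕ.NonZero k}} x → 0# ≤ x → Carrier
  root k x 0≤x = proj₁ (root-supremum k 0≤x)

  infix 9 _^⟨_/_,_⟩

  -- The rational power x^(a/b) of a non-negative number.
  _^⟨_/_,_⟩ : ∀ x (a b : ℕ) .{{_ : ℕ.NonZero b}} → 0# ≤ x → Carrier
  x ^⟨ a / b , 0≤x ⟩ = root b (x ^ a) (^-nonneg a 0≤x)

  -- The estimate (1 - y/n)⁻ⁿ decreases to eʸ as n > y tends to infinity, so eʸ < x
  -- means that nⁿ < x (n - y)ⁿ for some n > y.
  Exp< : Carrier → Pred Carrier 0ℓ
  Exp< x y = ∃[ k ] (let n = fromℕ (ℕ.suc k) in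
    y < n × n ^ ℕ.suc k < x * (n - y) ^ ℕ.suc k)

  weighted-AM-GM : ∀ i j {y} → let m = ℕ.suc i; n = ℕ.suc j in
    0# < fromℕ m + y → 0# < fromℕ n - y →
    (fromℕ m + y) ^ m * (fromℕ n - y) ^ n ≤ fromℕ m ^ m * fromℕ n ^ n
  weighted-AM-GM i j {y} 0<M+y 0<N-y =
    ≤-respˡ (sym (trans
      (*-cong (trans (^-congˡ m M+y≈) (^-distrib-* M p m))
              (trans (^-congˡ n N-y≈) (^-distrib-* N q n)))
      (interchange (M ^ m) (p ^ m) (N ^ n) (q ^ n))))
    (≤-respʳ (*-identityʳ _)
      (*-monoʳ-≤ (*-nonneg (^-nonneg m (fromℕ-nonneg m)) (^-nonneg n (fromℕ-nonneg n))) pq≤1))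
    where
    m = ℕ.suc i
    n = ℕ.suc j
    M = fromℕ m
    N = fromℕ n
    0<M = fromℕ-pos i
    0<N = fromℕ-pos j
    0<MN = *-pos 0<M 0<N
    t = y * (M * N) ⁻¹⟨ 0<MN ⟩
    p = 1# + N * t
    q = 1# + M * (- t)

    interchange : ∀ a b c d → (a * b) * (c * d) ≈ (a * c) * (b * d)
    interchange = solve 4 (λ a b c d → (a :* b) :* (c :* d) := (a :* c) :* (b :* d)) refl

    y≈ : y ≈ M * N * t
    y≈ = sym (trans
      (solve 3 (λ c y r → c :* (y :* r) := (r :* c) :* y) refl (M * N) y ((M * N) ⁻¹⟨ 0<MN ⟩))
      (trans (*-cong (⁻¹-inverseˡ 0<MN) refl) (*-identityˡ y)))

    M+y≈ : M + y ≈ M * p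
    M+y≈ = trans (+-congˡ y≈)
      (solve 3 (λ M N t → M :+ M :* N :* t := M :* (:1 :+ N :* t)) refl M N t)

    N-y≈ : N - y ≈ N * q
    N-y≈ = trans (+-congˡ (-‿cong y≈))
      (solve 3 (λ M N t → N :- M :* N :* t := N :* (:1 :+ M :* (:- t))) refl M N t)

    0<factor : ∀ {c x} → 0# < c → 0# < c * x → 0# < x
    0<factor {c} 0<c = *-cancelˡ-< 0<c ∘ <-respˡ (sym (zeroʳ c))

    0<1+ : ∀ l {s} → 0# < 1# + fromℕ (ℕ.suc l) * s → 0# < 1# + s
    0<1+ l {s} 0<1+ls = 0<factor (fromℕ-pos l) (<-respʳ
      (solve 2 (λ l s → l :+ (:1 :+ (:1 :+ l) :* s) := (:1 :+ l) :* (:1 :+ s)) refl (fromℕ l) s)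
      (≤-<-trans (fromℕ-nonneg l) (<-respˡ (+-identityʳ _) (+-monoʳ-< _ 0<1+ls))))

    0<p = 0<factor 0<M (<-respʳ M+y≈ 0<M+y)
    0<q = 0<factor 0<N (<-respʳ N-y≈ 0<N-y)
    0<1+t = 0<1+ j 0<p
    0<1-t = 0<1+ i 0<q

    u = (1# + t) * (1# - t)

    u≤1 : u ≤ 1#
    u≤1 = ≤-respˡ (solve 1 (λ t → (:1 :+ t) :* (:1 :- t) :+ t :* t :- t :* t := (:1 :+ t) :* (:1 :- t)) refl t)
      (≤-respʳ (solve 1 (λ t → (:1 :+ t :* t) :- t :* t := :1) refl t)
      (+-monoˡ-≤ (- (t * t)) (≤-respˡ
        (solve 1 (λ t → :1 := (:1 :+ t) :* (:1 :- t) :+ t :* t) refl t)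
        (≤-respˡ (+-identityʳ 1#) (+-monoʳ-≤ 1# (square-nonneg t))))))

    pq≤1 : p ^ m * q ^ n ≤ 1#
    pq≤1 = ≤-trans
      (≤-trans
        (*-monoˡ-≤ (^-nonneg n (<⇒≤ 0<q)) (^-mono-≤ m (<⇒≤ 0<p) (bernoulli n (<⇒≤ 0<1+t))))
        (*-monoʳ-≤ (^-nonneg m (^-nonneg n (<⇒≤ 0<1+t)))
          (^-mono-≤ n (<⇒≤ 0<q) (bernoulli m (<⇒≤ 0<1-t)))))
      (≤-respˡ (sym (trans
          (*-cong (trans (^-assocʳ (1# + t) n m) (^-congʳ (1# + t) (ℕ.*-comm n m)))
                  (^-assocʳ (1# - t) m n))
          (sym (^-distrib-* (1# + t) (1# - t) (m ℕ.* n)))))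
        (≤-respʳ (1^n≈1 (m ℕ.* n))
          (^-mono-≤ (m ℕ.* n) (<⇒≤ (*-pos 0<1+t 0<1-t)) u≤1)))

  Exp<-upperBound : ∀ k {x y} → let n = ℕ.suc k in
    0# < fromℕ n + y → x * fromℕ n ^ n < (fromℕ n + y) ^ n → IsUpperBound (Exp< x) y
  Exp<-upperBound k {x} {y} 0<n+y below {z} (j , z<m , above) y<z =
    weighted-AM-GM k j 0<n+y (<-trans 0<m-z m-z<m-y)
      (<-trans (*-monoʳ-< (^-pos n (fromℕ-pos k)) above)
      (<-trans
        (<-respˡ (solve 3 (λ x a b → (x :* a) :* b := a :* (x :* b)) refl
                    x (fromℕ n ^ n) ((fromℕ m - z) ^ m))
          (*-monoˡ-< (^-pos m 0<m-z) below))
        (*-monoʳ-< (^-pos n 0<n+y) (^-mono-< m (<⇒≤ 0<m-z) m-z<m-y))))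
    where
    n = ℕ.suc k
    m = ℕ.suc j
    0<m-z = <⇒0<- z<m

    m-z<m-y : fromℕ m - z < fromℕ m - y
    m-z<m-y = +-monoʳ-< (fromℕ m) (neg-anti-< y<z)

  Exp<-located : ∀ {x} → 0# < x → IsLocated (Exp< x)
  Exp<-located {x} 0<x {y} {z} y<z = [ inj₁ ∘ lower , inj₂ ∘ upper ]′
    (<-cotrans gap (x * (N - y′) ^ n * N ^ n))
    where
    y′ = proj₁ (dense y<z)
    y<y′ = proj₁ (proj₂ (dense y<z))
    y′<z = proj₂ (proj₂ (dense y<z))
    d = z - y′
    0<d = <⇒0<- y′<z
    d⁻¹ = d ⁻¹⟨ 0<d ⟩
    k₁ = proj₁ (archimedean y′)
    k₂ = proj₁ (archimedean (- z))
    k₃ = proj₁ (archimedean (y′ * z * d⁻¹))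
    k = k₁ ℕ.+ (k₂ ℕ.+ k₃)
    n = ℕ.suc k
    N = fromℕ n
    0<N^n = ^-pos n (fromℕ-pos k)

    fromℕ-mono : ∀ {i j} → i ℕ.≤ j → fromℕ i ≤ fromℕ j
    fromℕ-mono {j = j} ℕ.z≤n = fromℕ-nonneg j
    fromℕ-mono (ℕ.s≤s i≤j)   = +-monoʳ-≤ 1# (fromℕ-mono i≤j)

    y′<N : y′ < N
    y′<N = <-≤-trans (proj₂ (archimedean y′))
      (fromℕ-mono (ℕ.m≤n⇒m≤1+n (ℕ.m≤m+n k₁ (k₂ ℕ.+ k₃))))

    -z<N : - z < N
    -z<N = <-≤-trans (proj₂ (archimedean (- z)))
      (fromℕ-mono (ℕ.m≤n⇒m≤1+n (ℕ.≤-trans (ℕ.m≤m+n k₂ k₃) (ℕ.m≤n+m (k₂ ℕ.+ k₃) k₁))))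

    y′zd⁻¹<N : y′ * z * d⁻¹ < N
    y′zd⁻¹<N = <-≤-trans (proj₂ (archimedean (y′ * z * d⁻¹)))
      (fromℕ-mono (ℕ.m≤n⇒m≤1+n (ℕ.≤-trans (ℕ.m≤n+m k₃ k₂) (ℕ.m≤n+m (k₂ ℕ.+ k₃) k₁))))

    y′z<Nd : y′ * z < N * d
    y′z<Nd = <-respˡ
      (trans (*-assoc (y′ * z) d⁻¹ d) (trans (*-congˡ (⁻¹-inverseˡ 0<d)) (*-identityʳ _)))
      (*-monoˡ-< 0<d y′zd⁻¹<N)

    0<N-y′ : 0# < N - y′
    0<N-y′ = <⇒0<- y′<N

    0<N+z : 0# < N + z
    0<N+z = <-respʳ (solve 2 (λ N z → N :- (:- z) := N :+ z) refl N z) (<⇒0<- -z<N)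

    NN< : N * N < (N - y′) * (N + z)
    NN< = <-respʳ
      (solve 3 (λ N y z → N :* N :+ (N :* (z :- y) :- y :* z) := (N :- y) :* (N :+ z)) refl N y′ z)
      (<-respˡ (+-identityʳ _) (+-monoʳ-< (N * N) (<⇒0<- y′z<Nd)))

    gap : N ^ n * N ^ n < (N - y′) ^ n * (N + z) ^ n
    gap = <-respˡ (^-distrib-* N N n) (<-respʳ (^-distrib-* (N - y′) (N + z) n)
      (^-mono-< n (<⇒≤ (*-pos (fromℕ-pos k) (fromℕ-pos k))) NN<))

    lower : N ^ n * N ^ n < x * (N - y′) ^ n * N ^ n → ∃[ a ] Exp< x a × y < a
    lower p = y′ , (k , y′<N , *-cancelʳ-< 0<N^n p) , y<y′

    upper : x * (N - y′) ^ n * N ^ n < (N - y′) ^ n * (N + z) ^ n → IsUpperBound (Exp< x) z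
    upper p = Exp<-upperBound k 0<N+z (*-cancelˡ-< (^-pos n 0<N-y′) (<-respˡ
      (solve 3 (λ x a b → (x :* a) :* b := a :* (x :* b)) refl x ((N - y′) ^ n) (N ^ n)) p))

  log-supremum : ∀ {x} → 0# < x → ∃ (IsSupremum (Exp< x))
  log-supremum {x} 0<x = supremum (Exp< x) inhabited (x , bounded) (Exp<-located 0<x)
    where
    x⁻¹ = x ⁻¹⟨ 0<x ⟩

    inhabited : ∃ (Exp< x)
    inhabited = - x⁻¹ , 0 ,
      <-trans (<-respʳ -0#≈0# (neg-anti-< (⁻¹-pos 0<x))) (fromℕ-pos 0) ,
      <-respʳ
          (sym (trans (solve 3 (λ x w n → x :* ((n :- (:- w)) :* :1) := x :* n :+ x :* w) refl
                        x x⁻¹ (fromℕ 1))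
                      (+-cong (trans (*-congˡ (+-identityʳ 1#)) (*-identityʳ x))
                              (trans (⁻¹-inverseʳ 0<x) (sym (+-identityʳ 1#))))))
          (<-respˡ (trans (+-identityˡ _) (sym (*-identityʳ _))) (+-monoˡ-< (fromℕ 1) 0<x))

    bounded : IsUpperBound (Exp< x) x
    bounded = Exp<-upperBound 0
      (<-trans (fromℕ-pos 0) (<-respˡ (+-identityʳ _) (+-monoʳ-< (fromℕ 1) 0<x)))
      (<-respˡ (sym (trans (*-congˡ (trans (*-identityʳ _) (+-identityʳ 1#))) (*-identityʳ x)))
        (<-respʳ (sym (trans (*-identityʳ _) (+-congʳ (+-identityʳ 1#)))) (x<1+x x)))

  log : ∀ x → 0# < x → Carrier
  log x 0<x = proj₁ (log-supremum 0<x)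

module Plane (R : Reals) where

  open Reals R public
  open OrderedFieldProperties orderedField public
  open RealFunctions R public

  Point : Set
  Point = Carrier × Carrier

  pointSetoid : Setoid 0ℓ 0ℓ
  pointSetoid = ×-setoid setoid setoid

  tripleSetoid : Setoid 0ℓ 0ℓ
  tripleSetoid = ×-setoid pointSetoid (×-setoid pointSetoid pointSetoid)

  infix 4 _≈ₚ_

  _≈ₚ_ : Rel Point 0ℓ
  _≈ₚ_ = Setoid._≈_ pointSetoid

  infix 7 _·_

  _·_ : Point → Point → Carrier
  (x , y) · (u , v) = x * u + y * v

  distance : Point → Point → Carrier
  distance (x , y) (u , v) = root 2 ((x - u) * (x - u) + (y - v) * (y - v))
    (+-nonneg (square-nonneg (x - u)) (square-nonneg (y - v)))

  UnitSquare : Pred Point 0ℓ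
  UnitSquare (x , y) = (0# ≤ x × x ≤ 1#) × (0# ≤ y × y ≤ 1#)

  Separated : Carrier → Pred Point 0ℓ → Set
  Separated ε P = ∀ {p q} → P p → P q → ¬ (p ≈ₚ q) → ε ≤ distance p q

  Π : Carrier → Carrier → Pred Point 0ℓ → Pred (Point × Point × Point) 0ℓ
  Π α β P (p , q , r) = (P p × P q × P r) × p · q ≈ α × p · r ≈ β

  subset : (S : Setoid 0ℓ 0ℓ) → Pred (Setoid.Carrier S) 0ℓ → Setoid 0ℓ 0ℓ
  subset S A = On.setoid {B = Σ (Setoid.Carrier S) A} S proj₁

  HasCardinality : (S : Setoid 0ℓ 0ℓ) → Pred (Setoid.Carrier S) 0ℓ → ℕ → Set
  HasCardinality S A n = Inverse (≡.setoid (Fin n)) (subset S A)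

  -- |A| ≤ b, without deciding membership in A: no m distinct elements of A with m > b.
  CardinalityAtMost : (S : Setoid 0ℓ 0ℓ) → Pred (Setoid.Carrier S) 0ℓ → Carrier → Set
  CardinalityAtMost S A b = ∀ m → Injection (≡.setoid (Fin m)) (subset S A) → fromℕ m ≤ b

{-# OPTIONS --safe #-}

-- Put d(p) = #{q : p · q = α}.  By 2xy ≤ x² + y² it suffices to bound the energy Σ d(p)² for α and
-- for β.  Take k³ ≈ 2/ε, so that the grid of mesh 1/k³ has at most one point in each cell, and
-- group the cells into coarse cells of side 1/k².  The points p of the unit square have
-- non-negative coordinates, so the line p · q = α is antitone and its points on one of the
-- 2k² + 1 diagonals of coarse cells all lie in one coarse cell.  By Cauchy–Schwarz d(p)² is thus
-- bounded by O(k⁴) plus O(k²) times the number of pairs of points of the line in a common coarse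
-- cell.  Two points determine p and a coarse cell has at most k² points, so the energy is O(n k⁴).
-- If k³ ≤ n then n k ≤ n^(4/3), whence the bound O(n^(4/3)/ε); otherwise n ≤ k³ and the bound
-- O(n²) that comes from counting all pairs suffices.  Finally log(1/ε) ≥ 1 when ε < 1/4, and
-- a large n forces ε to be small.
module Submission where

open import Defs
import Algebra.Apartness.Properties.HeytingCommutativeRing
open import Algebra.Bundles using (CommutativeRing)
import Algebra.Properties.Ring
import Algebra.Properties.Semiring.Exp
import Algebra.Properties.Semiring.Mult
import Algebra.Properties.Semiring.Sum
open import Data.Bool.Base using (if_then_else_)
open import Data.Empty using (⊥)
open import Data.Fin.Base using (Fin; zero; suc; fromℕ<; combine)
import Data.Fin.Properties as Fin
open import Data.Nat.Base as ℕ using (ℕ; zero; suc)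
import Data.Nat.DivMod
import Data.Nat.Properties as ℕ
import Data.Nat.Solver
open import Data.Product using (∃-syntax; _×_; _,_; proj₁; proj₂)
open import Data.Sum.Base using (_⊎_; inj₁; inj₂; [_,_]′)
open import Data.Unit.Base using (tt)
open import Effect.Monad using (RawMonad)
open import Function.Base using (_∘_)
open import Function.Bundles using (Inverse; Injection)
open import Level using (0ℓ)
open import Relation.Binary.Bundles using (Setoid)
open import Relation.Binary.Core using (Rel)
import Relation.Binary.Definitions as Binary
open import Relation.Binary.PropositionalEquality as ≡ using (_≡_; _≢_)
open import Relation.Nullary using (¬_; Dec; does; yes; no; contradiction; _×-dec_; ¬?)
open import Relation.Nullary.Decidable using (¬¬-excluded-middle; decidable-stable)
open import Relation.Nullary.Negation using (DoubleNegation; ¬¬-Monad)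
open import Relation.Unary using (Pred; Decidable; _⊆_)

module ℕS = Data.Nat.Solver.+-*-Solver

-- Finite sums and counting in ℕ.

module Counting where

  open Algebra.Properties.Semiring.Sum ℕ.+-*-semiring
  open import Data.Nat.Base hiding (zero; suc; _/_; _%_)
  open Data.Nat.DivMod using (_/_; _%_; _mod_; m*n/n≡m; /-monoˡ-≤; m≡m%n+[m/n]*n; m%n<n)
  open import Data.Nat.Properties
  open ℕS using (solve; _:=_; _:+_; _:*_; con)
  open ≤-Reasoning

  sum-mono-≤ : ∀ {n} {f g : Fin n → ℕ} → (∀ i → f i ≤ g i) → sum f ≤ sum g
  sum-mono-≤ {zero}  f≤g = z≤n
  sum-mono-≤ {suc n} f≤g = +-mono-≤ (f≤g zero) (sum-mono-≤ (f≤g ∘ suc))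

  sum-const : ∀ n c → sum {n} (λ _ → c) ≡ n * c
  sum-const zero    c = ≡.refl
  sum-const (suc n) c = ≡.cong (c +_) (sum-const n c)

  -- Once the two numbers are ordered, the slack is the square `k * k` of their difference.
  2ab≤a²+b² : ∀ a b → 2 * (a * b) ≤ a * a + b * b
  2ab≤a²+b² a b with ≤-total a b
  ... | inj₁ a≤b with k , ≡.refl ← m≤n⇒∃[o]m+o≡n a≤b = begin
    2 * (a * (a + k))          ≤⟨ m≤m+n _ (k * k) ⟩
    2 * (a * (a + k)) + k * k
      ≡⟨ solve 2 (λ a k → con 2 :* (a :* (a :+ k)) :+ k :* k := a :* a :+ (a :+ k) :* (a :+ k))
           ≡.refl a k ⟩
    a * a + (a + k) * (a + k)  ∎
  ... | inj₂ b≤a with k , ≡.refl ← m≤n⇒∃[o]m+o≡n b≤a = begin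
    2 * ((b + k) * b)          ≤⟨ m≤m+n _ (k * k) ⟩
    2 * ((b + k) * b) + k * k
      ≡⟨ solve 2 (λ b k → con 2 :* ((b :+ k) :* b) :+ k :* k := (b :+ k) :* (b :+ k) :+ b :* b)
           ≡.refl b k ⟩
    (b + k) * (b + k) + b * b  ∎

  -- Induction on the number of terms. In the expanded square the cross term is estimated termwise
  -- by `2ab≤a²+b²`, which costs `n` copies of x² and one copy of the remaining squares.
  cauchy-schwarz : ∀ {n} (f : Fin n → ℕ) → sum f * sum f ≤ n * sum (λ i → f i * f i)
  cauchy-schwarz {zero}  f = z≤n
  cauchy-schwarz {suc n} f = begin
    (x + S) * (x + S)
      ≡⟨ solve 2 (λ x S → (x :+ S) :* (x :+ S) := x :* x :+ (con 2 :* x :* S :+ S :* S)) ≡.refl x S ⟩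
    x * x + (2 * x * S + S * S)
      ≤⟨ +-monoʳ-≤ (x * x) (+-mono-≤ cross (cauchy-schwarz (f ∘ suc))) ⟩
    x * x + (n * (x * x) + Q + n * Q)
      ≡⟨ solve 3 (λ x Q n → x :* x :+ (n :* (x :* x) :+ Q :+ n :* Q)
           := (x :* x :+ Q) :+ n :* (x :* x :+ Q)) ≡.refl x Q n ⟩
    suc n * (x * x + Q) ∎
    where
    x = f zero
    S = sum (f ∘ suc)
    Q = sum (λ i → f (suc i) * f (suc i))

    cross : 2 * x * S ≤ n * (x * x) + Q
    cross = begin
      2 * x * S                                       ≡⟨ *-distribˡ-sum (2 * x) (f ∘ suc) ⟩
      sum (λ i → 2 * x * f (suc i))
        ≤⟨ sum-mono-≤ (λ i →
             ≤-trans (≤-reflexive (*-assoc 2 x (f (suc i)))) (2ab≤a²+b² x (f (suc i)))) ⟩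
      sum (λ i → x * x + f (suc i) * f (suc i))       ≡⟨ ∑-distrib-+ (λ (_ : Fin n) → x * x) _ ⟩
      sum {n} (λ _ → x * x) + Q                       ≡⟨ ≡.cong (_+ Q) (sum-const n (x * x)) ⟩
      n * (x * x) + Q                                 ∎

  indicator : ∀ {P : Set} → Dec P → ℕ
  indicator P? = if does P? then 1 else 0

  indicator≤1 : ∀ {P : Set} (P? : Dec P) → indicator P? ≤ 1
  indicator≤1 (yes _) = ≤-refl
  indicator≤1 (no  _) = z≤n

  indicator-mono : ∀ {P Q : Set} (P? : Dec P) (Q? : Dec Q) → (P → Q) → indicator P? ≤ indicator Q?
  indicator-mono (no  _) Q?      P⇒Q = z≤n
  indicator-mono (yes _) (yes _) P⇒Q = ≤-refl
  indicator-mono (yes p) (no ¬q) P⇒Q = contradiction (P⇒Q p) ¬q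

  indicator-× : ∀ {P Q : Set} (P? : Dec P) (Q? : Dec Q) →
                indicator (P? ×-dec Q?) ≡ indicator P? * indicator Q?
  indicator-× (no  _) Q? = ≡.refl
  indicator-× (yes _) Q? = ≡.sym (*-identityˡ (indicator Q?))

  count : ∀ {n} {P : Pred (Fin n) 0ℓ} → Decidable P → ℕ
  count P? = sum (indicator ∘ P?)

  -- The bound is `indicator Q?` rather than 1 so that, when `Q` depends on a parameter, summing
  -- over the parameter counts the solutions of `Q`.
  count-unique : ∀ {n} {P : Pred (Fin n) 0ℓ} (P? : Decidable P) {Q : Set} (Q? : Dec Q) →
                 (∀ {i j} → P i → P j → i ≡ j) → (∀ {i} → P i → Q) → count P? ≤ indicator Q?
  count-unique {zero}  P? Q? unique P⇒Q = z≤n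
  count-unique {suc n} P? Q? unique P⇒Q with P? zero
  ... | no  _ = count-unique (P? ∘ suc) Q? (λ p q → Fin.suc-injective (unique p q)) P⇒Q
  ... | yes p = begin
    1 + count (P? ∘ suc)
      -- Any further solution would equal `zero`, so the remaining indicators vanish.
      ≤⟨ +-monoʳ-≤ 1 (sum-mono-≤ λ i →
           indicator-mono (P? (suc i)) (no λ ()) λ q → Fin.0≢1+n (unique p q)) ⟩
    1 + sum {n} (λ _ → 0) ≡⟨ ≡.cong suc (sum-replicate-zero n) ⟩
    1                     ≤⟨ indicator-mono (yes tt) Q? (λ _ → P⇒Q p) ⟩
    indicator Q?          ∎

  sum-select : ∀ {n} (i : Fin n) (f : Fin n → ℕ) → sum (λ c → indicator (i Fin.≟ c) * f c) ≡ f i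
  sum-select {suc n} zero    f = ≡.trans (≡.cong (f zero + 0 +_) (sum-replicate-zero n))
    (≡.trans (+-identityʳ _) (+-identityʳ _))
  sum-select {suc n} (suc i) f = sum-select i (f ∘ suc)

  -- Insert a Kronecker delta for the value of `R` by `sum-select`, then exchange the two sums.
  count-fibres : ∀ {m n} (R : Fin m → Fin n) {P : Pred (Fin m) 0ℓ} (P? : Decidable P) →
                 count P? ≡ sum (λ c → count (λ t → (R t Fin.≟ c) ×-dec P? t))
  count-fibres R P? = begin-equality
    count P?
      ≡⟨ sum-cong-≗ (λ t → sum-select (R t) (λ _ → indicator (P? t))) ⟨
    sum (λ t → sum (λ c → indicator (R t Fin.≟ c) * indicator (P? t)))
      ≡⟨ ∑-comm (λ t c → indicator (R t Fin.≟ c) * indicator (P? t)) ⟩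
    sum (λ c → sum (λ t → indicator (R t Fin.≟ c) * indicator (P? t)))
      ≡⟨ sum-cong-≗ (λ c → sum-cong-≗ (λ t → indicator-× (R t Fin.≟ c) (P? t))) ⟨
    sum (λ c → count (λ t → (R t Fin.≟ c) ×-dec P? t)) ∎

  count-fibres-≤ : ∀ {m n} (R : Fin m → Fin n) {P : Pred (Fin m) 0ℓ} (P? : Decidable P)
                   (w : Fin n → ℕ) → (∀ c → count (λ t → (R t Fin.≟ c) ×-dec P? t) ≤ w c) →
                   count P? ≤ sum w
  count-fibres-≤ R P? w fibre≤w = ≤-trans (≤-reflexive (count-fibres R P?)) (sum-mono-≤ fibre≤w)

  count-injective : ∀ {m n} (R : Fin m → Fin n) {P : Pred (Fin m) 0ℓ} (P? : Decidable P) →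
                    (∀ {i j} → P i → P j → R i ≡ R j → i ≡ j) → count P? ≤ n
  count-injective {n = n} R P? injective = ≤-trans
    (count-fibres-≤ R P? (λ _ → 1) λ c → count-unique (λ t → (R t Fin.≟ c) ×-dec P? t) (yes tt)
      (λ (Ri≡c , Pi) (Rj≡c , Pj) → injective Pi Pj (≡.trans Ri≡c (≡.sym Rj≡c))) (λ _ → tt))
    (≤-reflexive (≡.trans (sum-const n 1) (*-identityʳ n)))

  -- The energy of an incidence relation.

  energy : ∀ {n} {_∋_ : Rel (Fin n) 0ℓ} → Binary.Decidable _∋_ → ℕ
  energy _∋?_ = sum (λ i → count (i ∋?_) * count (i ∋?_))

  -- Points and lines share an index set, as in the duality that sends p to the line p · q = α.
  module Energy
    {n m h : ℕ}
    {_∋_ : Rel (Fin n) 0ℓ} (_∋?_ : Binary.Decidable _∋_)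
    {Close : Rel (Fin n) 0ℓ} (close? : Binary.Decidable Close)
    (class : Fin n → Fin m)
    (one-line : ∀ {i j q r} → q ≢ r → i ∋ q → i ∋ r → j ∋ q → j ∋ r → i ≡ j)
    (close    : ∀ {i q r} → i ∋ q → i ∋ r → class q ≡ class r → Close q r)
    (few-close : ∀ q → count (close? q) ≤ h)
    where

    richness : Fin n → ℕ
    richness i = count (i ∋?_)

    pair? : ∀ i q r → Dec ((q ≢ r × Close q r) × (i ∋ q × i ∋ r))
    pair? i q r = (¬? (q Fin.≟ r) ×-dec close? q r) ×-dec ((i ∋? q) ×-dec (i ∋? r))

    pairs : Fin n → ℕ
    pairs i = sum (λ q → count (pair? i q))

    -- Double counting: with the sum over lines innermost, distinct `q` and `r` lie on at most one
    -- common line, so each close pair is counted at most once.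
    pairs-total : sum pairs ≤ n * h
    pairs-total = begin
      sum (λ i → sum (λ q → count (pair? i q)))  ≡⟨ ∑-comm (λ i q → count (pair? i q)) ⟩
      sum (λ q → sum (λ i → count (pair? i q)))  ≤⟨ sum-mono-≤ per-point ⟩
      sum {n} (λ _ → h)                          ≡⟨ sum-const n h ⟩
      n * h                                      ∎
      where
      per-point : ∀ q → sum (λ i → count (pair? i q)) ≤ h
      per-point q = begin
        sum (λ i → count (pair? i q))
          ≡⟨ ∑-comm (λ i r → indicator (pair? i q r)) ⟩
        sum (λ r → count (λ i → pair? i q r))
          ≤⟨ sum-mono-≤ (λ r → count-unique (λ i → pair? i q r) (close? q r)
               (λ ((q≢r , _) , i∋q , i∋r) (_ , j∋q , j∋r) → one-line q≢r i∋q i∋r j∋q j∋r)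
               (λ ((_ , c) , _) → c)) ⟩
        count (close? q)
          ≤⟨ few-close q ⟩
        h ∎

    class-count : Fin n → Fin m → ℕ
    class-count i c = count (λ r → (class r Fin.≟ c) ×-dec (i ∋? r))

    -- The squares count ordered pairs of points of the line in a common class. The diagonal pairs
    -- make up `richness i`, and the others are close by `close`.
    class-energy : ∀ i → sum (λ c → class-count i c * class-count i c) ≤ richness i + pairs i
    class-energy i = begin
      sum (λ c → x c * x c)
        ≡⟨ sum-cong-≗ (λ c → *-distribʳ-sum (x c) (λ q → indicator ((class q Fin.≟ c) ×-dec (i ∋? q)))) ⟩
      sum (λ c → sum (λ q → indicator ((class q Fin.≟ c) ×-dec (i ∋? q)) * x c))
        ≡⟨ ∑-comm (λ c q → indicator ((class q Fin.≟ c) ×-dec (i ∋? q)) * x c) ⟩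
      sum (λ q → sum (λ c → indicator ((class q Fin.≟ c) ×-dec (i ∋? q)) * x c))
        ≡⟨ sum-cong-≗ (λ q → ≡.trans
             (sum-cong-≗ (λ c → ≡.trans (≡.cong (_* x c) (indicator-× (class q Fin.≟ c) (i ∋? q)))
               (*-assoc (indicator (class q Fin.≟ c)) (indicator (i ∋? q)) (x c))))
             (sum-select (class q) (λ c → indicator (i ∋? q) * x c))) ⟩
      sum (λ q → indicator (i ∋? q) * x (class q))
        ≤⟨ sum-mono-≤ per-point ⟩
      sum (λ q → indicator (i ∋? q) + count (pair? i q))
        ≡⟨ ∑-distrib-+ (λ q → indicator (i ∋? q)) (λ q → count (pair? i q)) ⟩
      richness i + pairs i ∎
      where
      x = class-count i

      per-point : ∀ q → indicator (i ∋? q) * x (class q) ≤ indicator (i ∋? q) + count (pair? i q)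
      per-point q with i ∋? q
      ... | no  _   = z≤n
      ... | yes i∋q = begin
        x (class q) + 0
          ≡⟨ +-identityʳ _ ⟩
        count (λ r → (class r Fin.≟ class q) ×-dec (i ∋? r))
          ≤⟨ sum-mono-≤ split ⟩
        -- The factor 1 gives the diagonal part the shape that `sum-select` evaluates.
        sum (λ r → indicator (q Fin.≟ r) * 1 + indicator (partner? r))
          ≡⟨ ∑-distrib-+ (λ r → indicator (q Fin.≟ r) * 1) (λ r → indicator (partner? r)) ⟩
        sum (λ r → indicator (q Fin.≟ r) * 1) + count partner?
          ≡⟨ ≡.cong (_+ count partner?) (sum-select q (λ _ → 1)) ⟩
        1 + count partner? ∎
        where
        -- This is `pair? i q` in the branch where `i ∋? q` is `yes i∋q`.
        partner? : ∀ r → Dec ((q ≢ r × Close q r) × (i ∋ q × i ∋ r))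
        partner? r = (¬? (q Fin.≟ r) ×-dec close? q r) ×-dec (yes i∋q ×-dec (i ∋? r))

        split : ∀ r → indicator ((class r Fin.≟ class q) ×-dec (i ∋? r)) ≤
                      indicator (q Fin.≟ r) * 1 + indicator (partner? r)
        split r with q Fin.≟ r
        ... | yes _   = ≤-trans (indicator≤1 ((class r Fin.≟ class q) ×-dec (i ∋? r))) (m≤m+n 1 _)
        ... | no  q≢r = indicator-mono ((class r Fin.≟ class q) ×-dec (i ∋? r))
          ((yes q≢r ×-dec close? q r) ×-dec (yes i∋q ×-dec (i ∋? r)))
          (λ (same , i∋r) → (q≢r , close i∋q i∋r (≡.sym same)) , i∋q , i∋r)

    -- Cauchy–Schwarz over the classes gives d² ≤ m (d + e), which bounds d² by 4 m² or by 2 m e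
    -- according to whether d ≤ 2 m.
    richness²≤ : ∀ i → richness i * richness i ≤ 4 * (m * m) + 2 * m * pairs i
    richness²≤ i with ≤-total (richness i) (2 * m)
    ... | inj₁ d≤2m = begin
      richness i * richness i
        ≤⟨ *-mono-≤ d≤2m d≤2m ⟩
      2 * m * (2 * m)
        ≡⟨ solve 1 (λ m → con 2 :* m :* (con 2 :* m) := con 4 :* (m :* m)) ≡.refl m ⟩
      4 * (m * m)
        ≤⟨ m≤m+n _ _ ⟩
      4 * (m * m) + 2 * m * pairs i ∎
    -- Doubling d² ≤ m (d + e) and absorbing 2 m d into one d² leaves d² ≤ 2 m e.
    ... | inj₂ 2m≤d = ≤-trans (+-cancelˡ-≤ (d * d) (d * d) (2 * m * e) (begin
      d * d + d * d
        ≡⟨ solve 1 (λ d → d :* d :+ d :* d := con 2 :* (d :* d)) ≡.refl d ⟩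
      2 * (d * d)
        ≤⟨ *-monoʳ-≤ 2 d²≤ ⟩
      2 * (m * (d + e))
        ≡⟨ solve 3 (λ m d e → con 2 :* (m :* (d :+ e)) := con 2 :* m :* d :+ con 2 :* m :* e)
             ≡.refl m d e ⟩
      2 * m * d + 2 * m * e
        ≤⟨ +-monoˡ-≤ (2 * m * e) (*-monoˡ-≤ d 2m≤d) ⟩
      d * d + 2 * m * e ∎)) (m≤n+m _ _)
      where
      d = richness i
      e = pairs i

      d²≤ : d * d ≤ m * (d + e)
      d²≤ = begin
        d * d
          ≡⟨ ≡.cong (λ d → d * d) (count-fibres class (i ∋?_)) ⟩
        sum (class-count i) * sum (class-count i)
          ≤⟨ cauchy-schwarz (class-count i) ⟩
        m * sum (λ c → class-count i c * class-count i c)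
          ≤⟨ *-monoʳ-≤ m (class-energy i) ⟩
        m * (d + e) ∎

    energy≤ : energy _∋?_ ≤ n * (4 * (m * m) + 2 * m * h)
    energy≤ = begin
      energy _∋?_
        ≤⟨ sum-mono-≤ richness²≤ ⟩
      sum (λ i → 4 * (m * m) + 2 * m * pairs i)
        ≡⟨ ∑-distrib-+ (λ (_ : Fin n) → 4 * (m * m)) _ ⟩
      sum {n} (λ _ → 4 * (m * m)) + sum (λ i → 2 * m * pairs i)
        ≡⟨ ≡.cong₂ _+_ (sum-const n _) (≡.sym (*-distribˡ-sum (2 * m) pairs)) ⟩
      n * (4 * (m * m)) + 2 * m * sum pairs
        ≤⟨ +-monoʳ-≤ _ (*-monoʳ-≤ (2 * m) pairs-total) ⟩
      n * (4 * (m * m)) + 2 * m * (n * h)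
        ≡⟨ solve 3 (λ n m h → n :* (con 4 :* (m :* m)) :+ con 2 :* m :* (n :* h)
             := n :* (con 4 :* (m :* m) :+ con 2 :* m :* h)) ≡.refl n m h ⟩
      n * (4 * (m * m) + 2 * m * h) ∎

  -- From energies to the number of triples.

  sum-*-≤ : ∀ {n b} (f g : Fin n → ℕ) →
            sum (λ i → f i * f i) ≤ b → sum (λ i → g i * g i) ≤ b → sum (λ i → f i * g i) ≤ b
  sum-*-≤ {b = b} f g ff≤b gg≤b = *-cancelˡ-≤ 2 (begin
    2 * sum (λ i → f i * g i)                      ≡⟨ *-distribˡ-sum 2 (λ i → f i * g i) ⟩
    sum (λ i → 2 * (f i * g i))                    ≤⟨ sum-mono-≤ (λ i → 2ab≤a²+b² (f i) (g i)) ⟩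
    sum (λ i → f i * f i + g i * g i)              ≡⟨ ∑-distrib-+ (λ i → f i * f i) _ ⟩
    sum (λ i → f i * f i) + sum (λ i → g i * g i)  ≤⟨ +-mono-≤ ff≤b gg≤b ⟩
    b + b                                          ≡⟨ ≡.cong (b +_) (+-identityʳ b) ⟨
    2 * b                                          ∎)

  -- The triples are fibred successively over `p`, `q` and `r`. A fibre over `i`, `j`, `k` has at
  -- most one element, and none unless both incidences hold. The resulting triple sum factors, for
  -- each `i`, into a product of two richnesses, to which `sum-*-≤` applies.
  hinge-count : ∀ {m n} {_∋_ _∋′_ : Rel (Fin n) 0ℓ}
    (_∋?_ : Binary.Decidable _∋_) (_∋′?_ : Binary.Decidable _∋′_)
    (p q r : Fin m → Fin n) → (∀ t → p t ∋ q t) → (∀ t → p t ∋′ r t) →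
    (∀ {s t} → p s ≡ p t → q s ≡ q t → r s ≡ r t → s ≡ t) →
    ∀ {b} → energy _∋?_ ≤ b → energy _∋′?_ ≤ b → m ≤ b
  hinge-count {m} {n} _∋?_ _∋′?_ p q r p∋q p∋′r injective {b} energy≤b energy′≤b = begin
    m                        ≡⟨ *-identityʳ m ⟨
    m * 1                    ≡⟨ sum-const m 1 ⟨
    count {m} (λ _ → yes tt) ≤⟨ count-fibres-≤ p (λ _ → yes tt) _ (λ i → begin
      count (on-p? i)
        ≤⟨ count-fibres-≤ q (on-p? i) _ (λ j → count-fibres-≤ r (on-pq? i j) _ (λ k → begin
             count (λ t → (r t Fin.≟ k) ×-dec on-pq? i j t)
               ≤⟨ count-unique (λ t → (r t Fin.≟ k) ×-dec on-pq? i j t) ((i ∋? j) ×-dec (i ∋′? k))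
                    (λ (rs , qs , ps , _) (rt , qt , pt , _) → injective
                      (≡.trans ps (≡.sym pt)) (≡.trans qs (≡.sym qt)) (≡.trans rs (≡.sym rt)))
                    (λ { {t} (≡.refl , ≡.refl , ≡.refl , _) → p∋q t , p∋′r t }) ⟩
             indicator ((i ∋? j) ×-dec (i ∋′? k))
               ≡⟨ indicator-× (i ∋? j) (i ∋′? k) ⟩
             indicator (i ∋? j) * indicator (i ∋′? k) ∎)) ⟩
      sum (λ j → sum (λ k → indicator (i ∋? j) * indicator (i ∋′? k)))
        ≡⟨ sum-cong-≗ (λ j → *-distribˡ-sum (indicator (i ∋? j)) (λ k → indicator (i ∋′? k))) ⟨
      sum (λ j → indicator (i ∋? j) * count (i ∋′?_))
        ≡⟨ *-distribʳ-sum (count (i ∋′?_)) (λ j → indicator (i ∋? j)) ⟨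
      count (i ∋?_) * count (i ∋′?_) ∎) ⟩
    sum (λ i → count (i ∋?_) * count (i ∋′?_))
      ≤⟨ sum-*-≤ (λ i → count (i ∋?_)) (λ i → count (i ∋′?_)) energy≤b energy′≤b ⟩
    b ∎
    where
    on-p? = λ i t → (p t Fin.≟ i) ×-dec yes tt
    on-pq? = λ i j t → (q t Fin.≟ j) ×-dec on-p? i t

  -- Along an antitone set, the k × k cells of the grid [0, k³]² are told apart by their diagonal
  -- x - y, which is shifted by k² here to stay in ℕ.
  module Grid
    {n : ℕ} (k : ℕ) .{{_ : NonZero k}} (x y : Fin n → ℕ)
    (x≤ : ∀ i → x i ≤ k * k * k) (y≤ : ∀ i → y i ≤ k * k * k)
    (xy-injective : ∀ {i j} → x i ≡ x j → y i ≡ y j → i ≡ j)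
    {_∋_ : Rel (Fin n) 0ℓ} (_∋?_ : Binary.Decidable _∋_)
    (one-line : ∀ {i j q r} → q ≢ r → i ∋ q → i ∋ r → j ∋ q → j ∋ r → i ≡ j)
    (antitone : ∀ {i q r} → i ∋ q → i ∋ r → x q < x r → y r ≤ y q)
    where

    cell-≤ : ∀ {c} → c ≤ k * k * k → c / k ≤ k * k
    cell-≤ c≤ = ≤-trans (/-monoˡ-≤ k c≤) (≤-reflexive (m*n/n≡m (k * k) k))

    /-cancel-< : ∀ {c d} → c / k < d / k → c < d
    /-cancel-< c/k<d/k = ≰⇒> (<⇒≱ c/k<d/k ∘ /-monoˡ-≤ k)

    diagonal : Fin n → ℕ
    diagonal i = x i / k + (k * k ∸ y i / k)

    diagonal< : ∀ i → diagonal i < suc (2 * (k * k))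
    diagonal< i = s≤s (+-mono-≤ (cell-≤ (x≤ i)) 
      (≤-trans (m∸n≤m (k * k) (y i / k)) (≤-reflexive (≡.sym (+-identityʳ _)))))

    class : Fin n → Fin (suc (2 * (k * k)))
    class i = fromℕ< (diagonal< i)

    SameCell : Rel (Fin n) 0ℓ
    SameCell q r = x q / k ≡ x r / k × y q / k ≡ y r / k

    sameCell? : Binary.Decidable SameCell
    sameCell? q r = (x q / k ≟ x r / k) ×-dec (y q / k ≟ y r / k)

    -- On a common diagonal a larger column forces a larger row, whereas an antitone line cannot
    -- rise.
    ¬steep : ∀ {i q r} → i ∋ q → i ∋ r → diagonal q ≡ diagonal r → ¬ (x q / k < x r / k)
    ¬steep {i} {q} {r} i∋q i∋r same xq<xr =
      <⇒≱ (/-cancel-< (∸-cancelʳ-< {y r / k} {y q / k} {k * k}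
        (+-cancelˡ-< (x q / k) _ _ (begin-strict
        x q / k + (k * k ∸ y r / k)  <⟨ +-monoˡ-< _ xq<xr ⟩
        diagonal r                   ≡⟨ same ⟨
        diagonal q                   ∎))))
      (antitone i∋q i∋r (/-cancel-< xq<xr))

    same-class⇒same-cell : ∀ {i q r} → i ∋ q → i ∋ r → class q ≡ class r → SameCell q r
    same-class⇒same-cell {i} {q} {r} i∋q i∋r classes≡ = x≡ ,
      -- Truncated subtraction from k² cancels because both rows are at most k².
      ∸-cancelˡ-≡ (cell-≤ (y≤ q)) (cell-≤ (y≤ r))
        (+-cancelˡ-≡ (x q / k) _ _ (≡.trans same (≡.cong (_+ (k * k ∸ y r / k)) (≡.sym x≡))))
      where
      same : diagonal q ≡ diagonal r
      same = Fin.fromℕ<-injective (diagonal q) (diagonal r) (diagonal< q) (diagonal< r) classes≡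

      x≡ : x q / k ≡ x r / k
      x≡ = ≤-antisym (≮⇒≥ (¬steep i∋r i∋q (≡.sym same))) (≮⇒≥ (¬steep i∋q i∋r same))

    /-%-injective : ∀ {c d} → c / k ≡ d / k → c % k ≡ d % k → c ≡ d
    /-%-injective {c} {d} q≡ r≡ = ≡.trans (m≡m%n+[m/n]*n c k)
      (≡.trans (≡.cong₂ (λ r q → r + q * k) r≡ q≡) (≡.sym (m≡m%n+[m/n]*n d k)))

    -- Within a coarse cell the remainders of the two coordinates modulo `k` determine the fine
    -- cell, hence the point.
    few-in-cell : ∀ q → count (sameCell? q) ≤ k * k
    few-in-cell q = count-injective (λ r → combine (x r mod k) (y r mod k)) (sameCell? q)
      λ {r} {s} (xr , yr) (xs , ys) e →
        let ex , ey = Fin.combine-injective (x r mod k) (y r mod k) (x s mod k) (y s mod k) e in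
        xy-injective
          (/-%-injective (≡.trans (≡.sym xr) xs) (mod-≡ ex))
          (/-%-injective (≡.trans (≡.sym yr) ys) (mod-≡ ey))
      where
      mod-≡ : ∀ {c d} → c mod k ≡ d mod k → c % k ≡ d % k
      mod-≡ {c} {d} = Fin.fromℕ<-injective _ _ (m%n<n c k) (m%n<n d k)

    -- With at most 3 k² classes and k² points in a coarse cell, the general bound has the
    -- coefficient 4 · 9 + 2 · 3 = 42 of n k⁴. The factor k³ is split off because it will be of
    -- order 1/ε.
    energy≤ : energy _∋?_ ≤ 42 * (n * k) * (k * k * k)
    energy≤ = begin
      energy _∋?_
        ≤⟨ Energy.energy≤ _∋?_ sameCell? class one-line same-class⇒same-cell few-in-cell ⟩
      n * (4 * (m * m) + 2 * m * (k * k))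
        ≤⟨ *-monoʳ-≤ n (+-mono-≤ (*-monoʳ-≤ 4 (*-mono-≤ m≤ m≤))
             (*-monoˡ-≤ (k * k) (*-monoʳ-≤ 2 m≤))) ⟩
      n * (4 * (3 * (k * k) * (3 * (k * k))) + 2 * (3 * (k * k)) * (k * k))
        ≡⟨ solve 2 (λ n k →
             n :* (con 4 :* (con 3 :* (k :* k) :* (con 3 :* (k :* k))) :+ con 2 :* (con 3 :* (k :* k)) :* (k :* k))
             := con 42 :* (n :* k) :* (k :* k :* k)) ≡.refl n k ⟩
      42 * (n * k) * (k * k * k) ∎
      where
      m = suc (2 * (k * k))

      m≤ : m ≤ 3 * (k * k)
      m≤ = +-monoˡ-≤ (2 * (k * k)) (*-mono-≤ (ℕ.>-nonZero⁻¹ k) (ℕ.>-nonZero⁻¹ k))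

  -- Take a single class in which all pairs count as close, so that `m` is 1 and `h` is `n`.
  trivial-energy≤ : ∀ {n} .{{_ : NonZero n}} {_∋_ : Rel (Fin n) 0ℓ} (_∋?_ : Binary.Decidable _∋_) →
    (∀ {i j q r} → q ≢ r → i ∋ q → i ∋ r → j ∋ q → j ∋ r → i ≡ j) →
    energy _∋?_ ≤ 6 * n * n
  trivial-energy≤ {n} _∋?_ one-line = begin
    energy _∋?_
      ≤⟨ Energy.energy≤ {m = 1} _∋?_ (λ _ _ → yes tt) (λ _ → zero) one-line (λ _ _ _ → tt)
           (λ q → ≤-reflexive (≡.trans (sum-const n 1) (*-identityʳ n))) ⟩
    n * (4 + 2 * n)
      ≤⟨ *-monoʳ-≤ n (+-monoˡ-≤ (2 * n) (m≤m*n 4 n)) ⟩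
    n * (4 * n + 2 * n)
      ≡⟨ solve 1 (λ n → n :* (con 4 :* n :+ con 2 :* n) := con 6 :* n :* n) ≡.refl n ⟩
    6 * n * n ∎

-- Comparison of reals is undecidable, but `≤` is a negation, so a proof of it may assume finitely
-- many instances of excluded middle at once.
¬¬-∀ : ∀ {n} {P : Pred (Fin n) 0ℓ} → (∀ i → DoubleNegation (P i)) → DoubleNegation (∀ i → P i)
¬¬-∀ = Fin.sequence (RawMonad.rawApplicative ¬¬-Monad)

¬¬-decidable : ∀ {n} (_∼_ : Rel (Fin n) 0ℓ) → DoubleNegation (Binary.Decidable _∼_)
¬¬-decidable _∼_ = ¬¬-∀ λ i → ¬¬-∀ λ j → ¬¬-excluded-middle

module _ (R : Reals) where

  open Plane R hiding (zero)
  open Counting using (energy; trivial-energy≤; hinge-count)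
  open Solver using (solve; _:=_; _:+_; _:*_; _:-_; :-_; :1)
  open CommutativeRing commutativeRing using (ring)
  open Algebra.Properties.Ring ring using (x[y-z]≈xy-xz)
  open Algebra.Properties.Semiring.Mult semiring using (×1-homo-*)
  open Algebra.Properties.Semiring.Exp semiring using (^-congˡ)
  private module HCR = Algebra.Apartness.Properties.HeytingCommutativeRing heytingCommutativeRing

  -- Naturals and floors in the reals.

  fromℕ-mono-≤ : ∀ {i j} → i ℕ.≤ j → fromℕ i ≤ fromℕ j
  fromℕ-mono-≤ {j = j} ℕ.z≤n = fromℕ-nonneg j
  fromℕ-mono-≤ (ℕ.s≤s i≤j)   = +-monoʳ-≤ 1# (fromℕ-mono-≤ i≤j)

  fromℕ-mono-< : ∀ {i j} → i ℕ.< j → fromℕ i < fromℕ j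
  fromℕ-mono-< {i} i<j = <-≤-trans (x<1+x (fromℕ i)) (fromℕ-mono-≤ i<j)

  fromℕ-cancel-< : ∀ {i j} → fromℕ i < fromℕ j → i ℕ.< j
  fromℕ-cancel-< i<j = ℕ.≰⇒> λ j≤i → fromℕ-mono-≤ j≤i i<j

  fromℕ-^ : ∀ i j → fromℕ (i ℕ.^ j) ≈ fromℕ i ^ j
  fromℕ-^ i zero    = +-identityʳ 1#
  fromℕ-^ i (suc j) = trans (×1-homo-* i (i ℕ.^ j)) (*-congˡ (fromℕ-^ i j))

  *-mono-≤ : ∀ {x y u v} → 0# ≤ u → 0# ≤ y → x ≤ y → u ≤ v → x * u ≤ y * v
  *-mono-≤ 0≤u 0≤y x≤y u≤v = ≤-trans (*-monoˡ-≤ 0≤u x≤y) (*-monoʳ-≤ 0≤y u≤v)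

  -- A relation rather than a function, since the floor of a real cannot be computed; `¬¬-floor`
  -- provides it under double negation.
  record Floor (x : Carrier) (a : ℕ) : Set where
    constructor _,_
    field
      lower : fromℕ a ≤ x
      upper : x < fromℕ (suc a)

  ¬¬-floor : ∀ n {x} → 0# ≤ x → x < fromℕ (suc n) → DoubleNegation (∃[ a ] a ℕ.≤ n × Floor x a)
  ¬¬-floor zero    0≤x x<1 = contradiction (zero , ℕ.z≤n , (0≤x , x<1))
  ¬¬-floor (suc n) {x} 0≤x x<2+n ¬floor = ¬¬-excluded-middle λ where
    (yes x<1+n) → ¬¬-floor n 0≤x x<1+n λ (a , a≤n , floor) → ¬floor (a , ℕ.m≤n⇒m≤1+n a≤n , floor)
    (no  1+n≤x) → ¬floor (suc n , ℕ.≤-refl , (1+n≤x , x<2+n))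

  floor-<⇒< : ∀ {m x y a b} → 0# < m → Floor (m * x) a → Floor (m * y) b → a ℕ.< b → x < y
  floor-<⇒< 0<m (_ , mx<1+a) (b≤my , _) a<b = *-cancelˡ-< 0<m
    (<-≤-trans mx<1+a (≤-trans (fromℕ-mono-≤ a<b) b≤my))

  -- Equality is the negation of apartness, and a product of elements apart from zero is apart from
  -- zero.
  *-cancelˡ-0 : ∀ {x y} → x ≉ 0# → x * y ≈ 0# → y ≈ 0#
  *-cancelˡ-0 {x} {y} x≉0 xy≈0 = proj₁ (tight y 0#) λ y#0 →
    x≉0 (proj₁ (tight x 0#) λ x#0 → proj₂ (tight (x * y) 0#) xy≈0 (HCR.x#0y#0→xy#0 x#0 y#0))

  x-y≈0⇒x≈y : ∀ {x y} → x - y ≈ 0# → x ≈ y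
  x-y≈0⇒x≈y {x} {y} x-y≈0 = trans (solve 2 (λ x y → x := (x :- y) :+ y) refl x y)
    (trans (+-congʳ x-y≈0) (+-identityˡ y))

  x≈y⇒x-y≈0 : ∀ {x y} → x ≈ y → x - y ≈ 0#
  x≈y⇒x-y≈0 {y = y} x≈y = trans (+-congʳ x≈y) (-‿inverseʳ y)

  -- Duality between points and lines.

  ·-cong : ∀ {p p′ q q′} → p ≈ₚ p′ → q ≈ₚ q′ → p · q ≈ p′ · q′
  ·-cong (u , v) (x , y) = +-cong (*-cong u x) (*-cong v y)

  -- α (q - r) is, up to a quarter turn, the determinant of q and r times p.
  det≈0⇒≈ : ∀ {α p} (q r : Point) → α ≉ 0# → p · q ≈ α → p · r ≈ α →
            proj₁ q * proj₂ r - proj₁ r * proj₂ q ≈ 0# → q ≈ₚ r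
  det≈0⇒≈ {α} {u , v} (x , y) (x′ , y′) α≉0 pq≈α pr≈α det≈0 =
    x-y≈0⇒x≈y (*-cancelˡ-0 α≉0 (trans (x[y-z]≈xy-xz α x x′)
      (trans (+-cong (*-congʳ (sym pr≈α)) (-‿cong (*-congʳ (sym pq≈α))))
      (trans (solve 6 (λ u v x y x′ y′ →
          (u :* x′ :+ v :* y′) :* x :- (u :* x :+ v :* y) :* x′ := v :* (x :* y′ :- x′ :* y))
          refl u v x y x′ y′)
        (trans (*-congˡ det≈0) (zeroʳ v)))))) ,
    x-y≈0⇒x≈y (*-cancelˡ-0 α≉0 (trans (x[y-z]≈xy-xz α y y′)
      (trans (+-cong (*-congʳ (sym pr≈α)) (-‿cong (*-congʳ (sym pq≈α))))
      (trans (solve 6 (λ u v x y x′ y′ →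
          (u :* x′ :+ v :* y′) :* y :- (u :* x :+ v :* y) :* y′ := (:- u) :* (x :* y′ :- x′ :* y))
          refl u v x y x′ y′)
        (trans (*-congˡ det≈0) (zeroʳ (- u)))))))

  -- Cramer's rule: the determinant of `q` and `r` times either coordinate of the difference of `p`
  -- and `p′` is a combination of differences of dot products, all zero. The determinant is nonzero
  -- by `det≈0⇒≈`.
  polar-unique : ∀ {α} (p p′ q r : Point) → α ≉ 0# → ¬ (q ≈ₚ r) →
                 p · q ≈ α → p · r ≈ α → p′ · q ≈ α → p′ · r ≈ α → p ≈ₚ p′
  polar-unique p@(u , v) p′@(u′ , v′) q@(x , y) r@(x′ , y′) α≉0 q≉r pq pr p′q p′r =
    x-y≈0⇒x≈y (*-cancelˡ-0 det≉0 (trans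
      (solve 8 (λ u v u′ v′ x y x′ y′ → (x :* y′ :- x′ :* y) :* (u :- u′) :=
        y′ :* ((u :* x :+ v :* y) :- (u′ :* x :+ v′ :* y))
          :+ (:- y) :* ((u :* x′ :+ v :* y′) :- (u′ :* x′ :+ v′ :* y′)))
        refl u v u′ v′ x y x′ y′) (combination y′ (- y)))) ,
    x-y≈0⇒x≈y (*-cancelˡ-0 det≉0 (trans
      (solve 8 (λ u v u′ v′ x y x′ y′ → (x :* y′ :- x′ :* y) :* (v :- v′) :=
        (:- x′) :* ((u :* x :+ v :* y) :- (u′ :* x :+ v′ :* y))
          :+ x :* ((u :* x′ :+ v :* y′) :- (u′ :* x′ :+ v′ :* y′)))
        refl u v u′ v′ x y x′ y′) (combination (- x′) x)))
    where
    det≉0 : x * y′ - x′ * y ≉ 0#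
    det≉0 = q≉r ∘ det≈0⇒≈ {p = p} q r α≉0 pq pr

    combination : ∀ a b → a * (p · q - p′ · q) + b * (p · r - p′ · r) ≈ 0#
    combination a b = trans (+-cong
      (trans (*-congˡ (x≈y⇒x-y≈0 (trans pq (sym p′q)))) (zeroʳ a))
      (trans (*-congˡ (x≈y⇒x-y≈0 (trans pr (sym p′r)))) (zeroʳ b))) (+-identityˡ 0#)

  -- If both coordinates increased from `q` to `r`, a positive coordinate of `p` would make p · r
  -- exceed p · q. So `p` would be the origin, and α would be zero.
  polar-antitone : ∀ {α} (p q r : Point) → α ≉ 0# → UnitSquare p → p · q ≈ α → p · r ≈ α →
                   proj₁ q < proj₁ r → proj₂ r ≤ proj₂ q
  polar-antitone {α} (u , v) (x , y) (x′ , y′) α≉0 ((0≤u , _) , (0≤v , _)) pq pr x<x′ y<y′ =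
    α≉0 (trans (sym pq) (trans
      (+-cong (trans (*-congʳ u≈0) (zeroˡ x)) (trans (*-congʳ v≈0) (zeroˡ y))) (+-identityˡ 0#)))
    where
    u≈0 : u ≈ 0#
    u≈0 = ≤-antisym (λ 0<u → <-irrefl (trans pq (sym pr))
      (<-≤-trans (+-monoˡ-< (v * y) (*-monoʳ-< 0<u x<x′)) 
        (+-monoʳ-≤ (u * x′) (*-monoʳ-≤ 0≤v (<⇒≤ y<y′))))) 0≤u

    v≈0 : v ≈ 0#
    v≈0 = ≤-antisym (λ 0<v → <-irrefl (trans pq (sym pr))
      (≤-<-trans (+-monoˡ-≤ (v * y) (*-monoʳ-≤ 0≤u (<⇒≤ x<x′))) 
        (+-monoʳ-< (u * x′) (*-monoʳ-< 0<v y<y′)))) 0≤v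

  -- Roots, the logarithm and the choice of k.

  ≤-root : ∀ k .{{_ : ℕ.NonZero k}} {x y} (0≤x : 0# ≤ x) → 0# ≤ y → y ^ k ≤ x → y ≤ root k x 0≤x
  ≤-root k 0≤x 0≤y y^k≤x = proj₁ (proj₂ (root-supremum k 0≤x)) (0≤y , y^k≤x)

  root-≤ : ∀ k .{{_ : ℕ.NonZero k}} {x y} (0≤x : 0# ≤ x) → 0# ≤ y → x ≤ y ^ k → root k x 0≤x ≤ y
  root-≤ k 0≤x 0≤y x≤y^k y<root =
    let a , (_ , a^k≤x) , y<a = proj₂ (proj₂ (root-supremum k 0≤x)) y<root in
    ≤-trans a^k≤x x≤y^k (^-mono-< k 0≤y y<a)

  -- The estimate (1 - y/n)⁻ⁿ of eʸ equals 4 at y = 1, n = 2.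
  1≤log : ∀ {x} (0<x : 0# < x) → fromℕ 2 ^ 2 < x → 1# ≤ log x 0<x
  1≤log {x} 0<x 4<x = proj₁ (proj₂ (log-supremum 0<x)) (1 ,
    <-respˡ (+-identityʳ 1#) (+-monoʳ-< 1# (fromℕ-pos 0)) ,
    <-respʳ (sym (trans (*-congˡ (trans (^-congˡ 2 2-1≈1) (1^n≈1 2))) (*-identityʳ x))) 4<x)
    where
    2-1≈1 : fromℕ 2 - 1# ≈ 1#
    2-1≈1 = trans (solve 2 (λ s t → (s :+ t) :- s := t) refl 1# (fromℕ 1)) (+-identityʳ 1#)

  x<2x : ∀ {x} → 0# < x → x < fromℕ 2 * x
  x<2x {x} 0<x = <-respˡ (*-identityˡ x) (*-monoˡ-< 0<x
    (<-respˡ (+-identityʳ 1#) (+-monoʳ-< 1# (fromℕ-pos 0))))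

  -- Descend from a large cube, comparing each next cube j³ with the gap between x and 2 x by
  -- cotransitivity. On stopping, j³ < 2 x and k = j + 1 ≤ 2 j, whence k³ ≤ 8 j³ ≤ 16 x.
  cube-between : ∀ {x} → 1# < x → ∃[ j ] (let k = suc j in
    x < fromℕ (k ℕ.* k ℕ.* k) × fromℕ (k ℕ.* k ℕ.* k) ≤ fromℕ 16 * x)
  cube-between {x} 1<x = search (proj₁ (archimedean x)) (<-≤-trans (proj₂ (archimedean x))
    (fromℕ-mono-≤ (j≤j³ (proj₁ (archimedean x)))))
    where
    j≤j³ : ∀ j → j ℕ.≤ j ℕ.* j ℕ.* j
    j≤j³ zero      = ℕ.z≤n
    j≤j³ j@(suc _) = ℕ.m≤n*m j (j ℕ.* j)

    0<x : 0# < x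
    0<x = <-trans 0<1 1<x

    8j³ : ∀ i → let j = suc i; k = suc j in k ℕ.* k ℕ.* k ℕ.≤ 8 ℕ.* (j ℕ.* j ℕ.* j)
    8j³ i = ℕ.≤-trans (ℕ.*-mono-≤ (ℕ.*-mono-≤ k≤2j k≤2j) k≤2j) (ℕ.≤-reflexive (ℕS.solve 1
      (λ j → (ℕS.con 2 ℕS.:* j) ℕS.:* (ℕS.con 2 ℕS.:* j) ℕS.:* (ℕS.con 2 ℕS.:* j)
         ℕS.:= ℕS.con 8 ℕS.:* (j ℕS.:* j ℕS.:* j)) ≡.refl (suc i)))
      where
      k≤2j : suc (suc i) ℕ.≤ 2 ℕ.* suc i
      k≤2j = ℕ.s≤s (ℕ.≤-trans (ℕ.m≤n+m (suc i) i)
        (ℕ.+-monoʳ-≤ i (ℕ.≤-reflexive (≡.sym (ℕ.+-identityʳ (suc i))))))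

    search : ∀ j → x < fromℕ (j ℕ.* j ℕ.* j) → ∃[ j ] (let k = suc j in
      x < fromℕ (k ℕ.* k ℕ.* k) × fromℕ (k ℕ.* k ℕ.* k) ≤ fromℕ 16 * x)
    search zero x<0 = contradiction x<0 (<-asym 0<x)
    -- Here 1 < x keeps j positive, without which k ≤ 2 j would fail.
    search (suc zero) x<1 = contradiction (<-respʳ (+-identityʳ 1#) x<1) (<-asym 1<x)
    search (suc j@(suc i)) x<k³ =
      [ search j
      , (λ j³<2x → j , x<k³ , ≤-trans (fromℕ-mono-≤ (8j³ i))
          (≤-respˡ (sym (×1-homo-* 8 (j ℕ.* j ℕ.* j)))
            (≤-respʳ (trans (sym (*-assoc _ _ _)) (*-congʳ (sym (×1-homo-* 8 2))))
              (*-monoʳ-≤ (fromℕ-nonneg 8) (<⇒≤ j³<2x)))))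
      ]′ (<-cotrans (x<2x 0<x) (fromℕ (j ℕ.* j ℕ.* j)))

  -- Points in a common cell.

  close-if-same-floor : ∀ {m x y a} → Floor (m * x) a → Floor (m * y) a →
                        m * m * ((x - y) * (x - y)) < 1#
  close-if-same-floor {m} {x} {y} (a≤mx , mx<) (a≤my , my<) = 0<-⇒< (<-respʳ
    (solve 3 (λ m x y → (:1 :+ m :* y :- m :* x) :* (:1 :+ m :* x :- m :* y)
      := :1 :- m :* m :* ((x :- y) :* (x :- y))) refl m x y)
    (*-pos (<⇒0<- (<-≤-trans mx< (+-monoʳ-≤ 1# a≤my))) (<⇒0<- (<-≤-trans my< (+-monoʳ-≤ 1# a≤mx)))))

  -- 2/m, twice the side of a cell, bounds the diameter of the cell.
  distance-in-cell : ∀ {m ε} (p q : Point) {a b} → 0# < m → fromℕ 2 < m * ε →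
    Floor (m * proj₁ p) a → Floor (m * proj₁ q) a → Floor (m * proj₂ p) b → Floor (m * proj₂ q) b →
    distance p q < ε
  distance-in-cell {m} {ε} p@(x , y) q@(x′ , y′) 0<m 2<mε px qx py qy =
    ≤-<-trans
      (root-≤ 2 (+-nonneg (square-nonneg (x - x′)) (square-nonneg (y - y′))) (<⇒≤ 0<z) D≤z²) z<ε
    where
    z = fromℕ 2 * m ⁻¹⟨ 0<m ⟩
    D = (x - x′) * (x - x′) + (y - y′) * (y - y′)

    0<z : 0# < z
    0<z = *-pos (fromℕ-pos 1) (⁻¹-pos 0<m)

    mz≈2 : m * z ≈ fromℕ 2
    mz≈2 = trans (solve 3 (λ m t i → m :* (t :* i) := t :* (m :* i)) refl m (fromℕ 2) (m ⁻¹⟨ 0<m ⟩))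
      (trans (*-congˡ (⁻¹-inverseʳ 0<m)) (*-identityʳ _))

    z<ε : z < ε
    z<ε = *-cancelˡ-< 0<m (<-respˡ (sym mz≈2) 2<mε)

    m²D<2 : m * m * D < fromℕ 2
    m²D<2 = <-respˡ (sym (distribˡ (m * m) _ _)) (<-respʳ (+-congˡ (sym (+-identityʳ 1#)))
      (+-mono-< (close-if-same-floor px qx) (close-if-same-floor py qy)))

    m²z²≈4 : m * m * z ^ 2 ≈ fromℕ 4
    m²z²≈4 = trans (solve 2 (λ m z → m :* m :* (z :* (z :* :1)) := (m :* z) :* (m :* z)) refl m z)
      (trans (*-cong mz≈2 mz≈2) (sym (×1-homo-* 2 2)))

    D≤z² : D ≤ z ^ 2
    D≤z² z²<D = fromℕ-mono-≤ {2} {4} (ℕ.s≤s (ℕ.s≤s ℕ.z≤n))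
      (<-trans (<-respˡ m²z²≈4 (*-monoʳ-< (*-pos 0<m 0<m) z²<D)) m²D<2)

  -- An enumerated separated set, its polars and its cells.

  module SeparatedSet
    {n : ℕ} {ε : Carrier} (P : Pred Point 0ℓ) (P⊆□ : P ⊆ UnitSquare)
    (enumeration : HasCardinality pointSetoid P n) (separated : Separated ε P)
    where

    point : Fin n → Point
    point i = proj₁ (Inverse.to enumeration i)

    point∈P : ∀ i → P (point i)
    point∈P i = proj₂ (Inverse.to enumeration i)

    index : ∀ {p} → P p → Fin n
    index {p} p∈P = Inverse.from enumeration (p , p∈P)

    point-index : ∀ {p} (p∈P : P p) → point (index p∈P) ≈ₚ p
    point-index p∈P = Inverse.strictlyInverseˡ enumeration (_ , p∈P)

    point-injective : ∀ {i j} → point i ≈ₚ point j → i ≡ j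
    point-injective {i} {j} e = ≡.trans (≡.sym (Inverse.strictlyInverseʳ enumeration i))
      (≡.trans (Inverse.from-cong enumeration e) (Inverse.strictlyInverseʳ enumeration j))

    index-injective : ∀ {p q} (p∈P : P p) (q∈P : P q) → index p∈P ≡ index q∈P → p ≈ₚ q
    index-injective p∈P q∈P e = P.trans (P.sym (point-index p∈P))
      (P.trans (P.reflexive (≡.cong point e)) (point-index q∈P))
      where
      module P = Setoid pointSetoid

    OnPolar : Carrier → Rel (Fin n) 0ℓ
    OnPolar α i j = point i · point j ≈ α

    on-one-polar : ∀ {α} → α ≉ 0# → ∀ {i j q r} → q ≢ r →
      OnPolar α i q → OnPolar α i r → OnPolar α j q → OnPolar α j r → i ≡ j
    on-one-polar α≉0 {i} {j} {q} {r} q≢r iq ir jq jr = point-injective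
      (polar-unique (point i) (point j) (point q) (point r) α≉0 (q≢r ∘ point-injective) iq ir jq jr)

    -- Up to m inclusive, as the top and the right edge of the square have cells of their own.
    record Cell (m : ℕ) (i : Fin n) : Set where
      field
        x y     : ℕ
        x≤      : x ℕ.≤ m
        y≤      : y ℕ.≤ m
        x-floor : Floor (fromℕ m * proj₁ (point i)) x
        y-floor : Floor (fromℕ m * proj₂ (point i)) y

    ¬¬-cell : ∀ m i → DoubleNegation (Cell m i)
    ¬¬-cell m i ¬cell =
      let (0≤x , x≤1) , (0≤y , y≤1) = P⊆□ (point∈P i) in
      ¬¬-floor m (*-nonneg (fromℕ-nonneg m) 0≤x) (scaled x≤1) λ (a , a≤m , a-floor) →
      ¬¬-floor m (*-nonneg (fromℕ-nonneg m) 0≤y) (scaled y≤1) λ (b , b≤m , b-floor) →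
      ¬cell record { x≤ = a≤m ; y≤ = b≤m ; x-floor = a-floor ; y-floor = b-floor }
      where
      scaled : ∀ {x} → x ≤ 1# → fromℕ m * x < fromℕ (suc m)
      scaled x≤1 = ≤-<-trans (≤-respʳ (*-identityʳ _) (*-monoʳ-≤ (fromℕ-nonneg m) x≤1)) (x<1+x _)

    module Cells {m : ℕ} (0<m : 0# < fromℕ m) (2<mε : fromℕ 2 < fromℕ m * ε)
      (cell : ∀ i → Cell m i) where

      open module C i = Cell (cell i) public

      -- Distinct points in one cell would be closer than ε. Equality of indices is decidable, so
      -- arguing by contradiction is allowed.
      cell-injective : ∀ {i j} → x i ≡ x j → y i ≡ y j → i ≡ j
      cell-injective {i} {j} xi≡xj yi≡yj = decidable-stable (i Fin.≟ j) λ i≢j →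
        separated (point∈P i) (point∈P j) (i≢j ∘ point-injective)
          (distance-in-cell (point i) (point j) 0<m 2<mε
            (x-floor i) (≡.subst (Floor _) (≡.sym xi≡xj) (x-floor j))
            (y-floor i) (≡.subst (Floor _) (≡.sym yi≡yj) (y-floor j)))

      cardinality≤ : n ℕ.≤ suc m ℕ.* suc m
      cardinality≤ = Fin.injective⇒≤ {f = λ i → combine (xᶠ i) (yᶠ i)} λ {i} {j} e →
        let ex , ey = Fin.combine-injective (xᶠ i) (yᶠ i) (xᶠ j) (yᶠ j) e in
        cell-injective (Fin.fromℕ<-injective _ _ _ _ ex) (Fin.fromℕ<-injective _ _ _ _ ey)
        where
        xᶠ yᶠ : Fin n → Fin (suc m)
        xᶠ i = fromℕ< (ℕ.s≤s (x≤ i))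
        yᶠ i = fromℕ< (ℕ.s≤s (y≤ i))

      polar-antitone-cells : ∀ {α} → α ≉ 0# → ∀ {i q r} → OnPolar α i q → OnPolar α i r →
        x q ℕ.< x r → y r ℕ.≤ y q
      polar-antitone-cells α≉0 {i} {q} {r} iq ir xq<xr = ℕ.≮⇒≥ λ yq<yr →
        polar-antitone (point i) (point q) (point r) α≉0 (P⊆□ (point∈P i)) iq ir
          (floor-<⇒< 0<m (x-floor q) (x-floor r) xq<xr) (floor-<⇒< 0<m (y-floor q) (y-floor r) yq<yr)

    hinges≤ : ∀ {α β} {N : ℕ} → Injection (≡.setoid (Fin N)) (subset tripleSetoid (Π α β P)) →
      (α? : Binary.Decidable (OnPolar α)) (β? : Binary.Decidable (OnPolar β)) →
      ∀ {b} → energy α? ℕ.≤ b → energy β? ℕ.≤ b → N ℕ.≤ b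
    hinges≤ {α} {β} {N} hinges α? β? = hinge-count α? β?
      (λ t → index (p∈P t)) (λ t → index (q∈P t)) (λ t → index (r∈P t))
      (λ t → trans (·-cong (point-index (p∈P t)) (point-index (q∈P t))) (pq t))
      (λ t → trans (·-cong (point-index (p∈P t)) (point-index (r∈P t))) (pr t))
      (λ {s} {t} ep eq er → Injection.injective hinges
        ( index-injective (p∈P s) (p∈P t) ep
        , index-injective (q∈P s) (q∈P t) eq
        , index-injective (r∈P s) (r∈P t) er))
      where
      module _ (t : Fin N) where
        hinge = proj₂ (Injection.to hinges t)
        p∈P = proj₁ (proj₁ hinge)
        q∈P = proj₁ (proj₂ (proj₁ hinge))
        r∈P = proj₂ (proj₂ (proj₁ hinge))
        pq  = proj₁ (proj₂ hinge)
        pr  = proj₂ (proj₂ hinge)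

  -- Constants and arithmetic of the final estimate.

  fromℕ≤n^4/3 : ∀ s n → s ℕ.^ 3 ℕ.≤ n ℕ.^ 4 → fromℕ s ≤ fromℕ n ^⟨ 4 / 3 , fromℕ-nonneg n ⟩
  fromℕ≤n^4/3 s n s³≤n⁴ = ≤-root 3 (^-nonneg 4 (fromℕ-nonneg n)) (fromℕ-nonneg s)
    (≤-respˡ (fromℕ-^ s 3) (≤-respʳ (fromℕ-^ n 4) (fromℕ-mono-≤ s³≤n⁴)))

  -- 42 comes from the energy bound on the grid, and k³ ≤ 16 · 2/ε.
  constant : Carrier
  constant = fromℕ 42 * (fromℕ 16 * fromℕ 2)

  0<constant : 0# < constant
  0<constant = *-pos (fromℕ-pos 41) (*-pos (fromℕ-pos 15) (fromℕ-pos 1))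

  -- If 1/ε < 5, then the grid of mesh 1/10, with 11² cells, separates the points.
  threshold : Carrier
  threshold = fromℕ 121

  0<threshold : 0# < threshold
  0<threshold = fromℕ-pos 120

  -- The common end of both cases: `s` is n k for the grid bound and n for the trivial bound. `w`
  -- stands for 1/ε and `ℓ` for its logarithm.
  collect : ∀ {N} s k³ n {w ℓ} → N ℕ.≤ 42 ℕ.* s ℕ.* k³ → s ℕ.^ 3 ℕ.≤ n ℕ.^ 4 →
    fromℕ k³ ≤ fromℕ 16 * (fromℕ 2 * w) → 0# ≤ w → 1# ≤ ℓ →
    fromℕ N ≤ constant * fromℕ n ^⟨ 4 / 3 , fromℕ-nonneg n ⟩ * w * ℓ
  collect s k³ n {w} N≤ s³≤n⁴ k³≤ 0≤w 1≤ℓ = ≤-trans (fromℕ-mono-≤ N≤) (≤-trans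
    (≤-respˡ (sym (trans (×1-homo-* (42 ℕ.* s) k³) (*-congʳ (×1-homo-* 42 s))))
      (*-mono-≤ (fromℕ-nonneg k³) (*-nonneg (fromℕ-nonneg 42) 0≤ρ)
        (*-monoʳ-≤ (fromℕ-nonneg 42) (fromℕ≤n^4/3 s n s³≤n⁴)) k³≤))
    (≤-respˡ (solve 5 (λ a ρ b c w → (a :* (b :* c)) :* ρ :* w := (a :* ρ) :* (b :* (c :* w))) refl
        (fromℕ 42) ρ (fromℕ 16) (fromℕ 2) w)
      (≤-respˡ (*-identityʳ _)
        (*-monoʳ-≤ (*-nonneg (*-nonneg (<⇒≤ 0<constant) 0≤ρ) 0≤w) 1≤ℓ))))
    where
    ρ = fromℕ n ^⟨ 4 / 3 , fromℕ-nonneg n ⟩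

    0≤ρ : 0# ≤ ρ
    0≤ρ = ≤-trans (fromℕ-nonneg s) (fromℕ≤n^4/3 s n s³≤n⁴)

  [nk]³≤n⁴ : ∀ n k → k ℕ.* k ℕ.* k ℕ.≤ n → (n ℕ.* k) ℕ.^ 3 ℕ.≤ n ℕ.^ 4
  [nk]³≤n⁴ n k k³≤n = ℕ.≤-trans
    (ℕ.≤-reflexive (ℕS.solve 2
      (λ n k → (n ℕS.:* k) ℕS.:^ 3 ℕS.:= n ℕS.:^ 3 ℕS.:* (k ℕS.:* k ℕS.:* k)) ≡.refl n k))
    (ℕ.≤-trans (ℕ.*-monoʳ-≤ (n ℕ.^ 3) k³≤n)
      (ℕ.≤-reflexive (ℕS.solve 1 (λ n → n ℕS.:^ 3 ℕS.:* n ℕS.:= n ℕS.:^ 4) ≡.refl n)))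

  -- The bound for one point set.

  module _ {α β} (α≉0 : α ≉ 0#) (β≉0 : β ≉ 0#) {n} (threshold<n : threshold < fromℕ n)
    {ε w} (0<w : 0# < w) (wε≈1 : w * ε ≈ 1#) (P : Pred Point 0ℓ) (P⊆□ : P ⊆ UnitSquare)
    (enumeration : HasCardinality pointSetoid P n) (separated : Separated ε P) where

    open SeparatedSet P P⊆□ enumeration separated

    instance
      n≢0 : ℕ.NonZero n
      n≢0 = ℕ.>-nonZero (ℕ.≤-<-trans ℕ.z≤n (fromℕ-cancel-< {121} {n} threshold<n))

    0<ε : 0# < ε
    0<ε = *-cancelˡ-< 0<w (<-respˡ (sym (zeroʳ w)) (<-respʳ (sym wε≈1) 0<1))

    2w<⇒2<ε : ∀ {x} → fromℕ 2 * w < x → fromℕ 2 < x * ε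
    2w<⇒2<ε 2w<x = <-respˡ
      (trans (*-assoc _ w ε) (trans (*-congˡ wε≈1) (*-identityʳ _)))
      (*-monoˡ-< 0<ε 2w<x)

    w≮5 : ¬ (w < fromℕ 5)
    w≮5 w<5 = ¬¬-∀ (¬¬-cell 10) λ cell →
      fromℕ-mono-≤ {n} {121} (Cells.cardinality≤ (fromℕ-pos 9) (2w<⇒2<ε 2w<10) cell) threshold<n
      where
      2w<10 : fromℕ 2 * w < fromℕ 10
      2w<10 = <-respʳ (sym (×1-homo-* 2 5)) (*-monoʳ-< (fromℕ-pos 1) w<5)

    1<2w : fromℕ 2 ^ 2 < w → 1# < fromℕ 2 * w
    1<2w 4<w = <-trans (<-trans (<-respˡ (+-identityʳ 1#) (<-respʳ (fromℕ-^ 2 2) 1<4)) 4<w) (x<2x 0<w)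
      where
      1<4 : fromℕ 1 < fromℕ 4
      1<4 = fromℕ-mono-< {1} {4} (ℕ.s≤s (ℕ.s≤s ℕ.z≤n))

    hinges-bound-mesh : ∀ {N} → Injection (≡.setoid (Fin N)) (subset tripleSetoid (Π α β P)) →
      ∀ k .{{_ : ℕ.NonZero k}} → let k³ = k ℕ.* k ℕ.* k in
      fromℕ 2 * w < fromℕ k³ → fromℕ k³ ≤ fromℕ 16 * (fromℕ 2 * w) → 1# ≤ log w 0<w →
      fromℕ N ≤ constant * fromℕ n ^⟨ 4 / 3 , fromℕ-nonneg n ⟩ * w * log w 0<w
    hinges-bound-mesh hinges k 2w<k³ k³≤32w 1≤log-w bound<N =
      -- The goal is now absurdity, so the cells of all points and both incidence relations may be
      -- taken as decided.
      ¬¬-∀ (¬¬-cell k³) λ cell → ¬¬-decidable (OnPolar α) λ α? → ¬¬-decidable (OnPolar β) λ β? →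
      cases cell α? β? (ℕ.≤-total k³ n)
      where
      k³ = k ℕ.* k ℕ.* k

      0<k³ : 0# < fromℕ k³
      0<k³ = <-trans (*-pos (fromℕ-pos 1) 0<w) 2w<k³

      cases : (∀ i → Cell k³ i) → Binary.Decidable (OnPolar α) → Binary.Decidable (OnPolar β) →
              k³ ℕ.≤ n ⊎ n ℕ.≤ k³ → ⊥
      cases cell α? β? (inj₁ k³≤n) = collect (n ℕ.* k) k³ n
        (hinges≤ hinges α? β? (polar-energy≤ α≉0 α?) (polar-energy≤ β≉0 β?))
        ([nk]³≤n⁴ n k k³≤n) k³≤32w (<⇒≤ 0<w) 1≤log-w bound<N
        where
        open Cells 0<k³ (2w<⇒2<ε 2w<k³) cell

        polar-energy≤ : ∀ {γ} → γ ≉ 0# → (γ? : Binary.Decidable (OnPolar γ)) →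
                        energy γ? ℕ.≤ 42 ℕ.* (n ℕ.* k) ℕ.* k³
        polar-energy≤ γ≉0 γ? = Counting.Grid.energy≤ k x y x≤ y≤ cell-injective γ?
          (on-one-polar γ≉0) (polar-antitone-cells γ≉0)
      cases cell α? β? (inj₂ n≤k³) = collect n k³ n
        (ℕ.≤-trans
          (hinges≤ hinges α? β?
            (trivial-energy≤ α? (on-one-polar α≉0)) (trivial-energy≤ β? (on-one-polar β≉0)))
          -- To fit `collect`, 6 is raised to 42 and one factor n to k³.
          (ℕ.*-mono-≤ (ℕ.*-monoˡ-≤ n (ℕ.m≤m+n 6 36)) n≤k³))
        (ℕ.^-monoʳ-≤ n (ℕ.n≤1+n 3)) k³≤32w (<⇒≤ 0<w) 1≤log-w bound<N

    hinges-bound : CardinalityAtMost tripleSetoid (Π α β P)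
      (constant * fromℕ n ^⟨ 4 / 3 , fromℕ-nonneg n ⟩ * w * log w 0<w)
    hinges-bound N hinges =
      -- `w` cannot be compared with a single number, but cotransitivity compares it with the gap
      -- between 4 and 5. Above 4 the logarithm is at least 1; below 5 there would be too few
      -- points.
      [ (λ 4<w → let j , 2w<k³ , k³≤32w = cube-between (1<2w 4<w) in
          hinges-bound-mesh hinges (suc j) 2w<k³ k³≤32w (1≤log 0<w 4<w))
      , (λ w<5 → contradiction w<5 w≮5)
      ]′ (<-cotrans (<-respˡ (fromℕ-^ 2 2) (fromℕ-mono-< {4} {5} ℕ.≤-refl)) w)

  -- The inequality comes first so that w and 0<w are inferred from its type: to convert between
  -- logarithms of distinct copies of one reciprocal would normalise all the proofs inside them.
  ¬too-many-hinges : ∀ {α β n ε w 0<w P N} →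
    constant * fromℕ n ^⟨ 4 / 3 , fromℕ-nonneg n ⟩ * w * log w 0<w < fromℕ N →
    w * ε ≈ 1# → α ≉ 0# → β ≉ 0# → threshold < fromℕ n →
    P ⊆ UnitSquare → HasCardinality pointSetoid P n → Separated ε P →
    ¬ Injection (≡.setoid (Fin N)) (subset tripleSetoid (Π α β P))
  ¬too-many-hinges {0<w = 0<w} {P} bound<N wε≈1 α≉0 β≉0 threshold<n P⊆□ enumeration separated hinges =
    hinges-bound α≉0 β≉0 threshold<n 0<w wε≈1 P P⊆□ enumeration separated _ hinges bound<N

theorem2 : (R : Reals) → let open Plane R in
    (α β : Carrier) → α ≉ 0# → β ≉ 0# →
    ∃[ C ] ∃[ N ] (0# < C) × (0# < N) ×
    ((n : ℕ) → N < fromℕ n →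
    (ε : Carrier) (0<ε : 0# < ε) →
    (P : Pred Point 0ℓ) → P ⊆ UnitSquare → HasCardinality pointSetoid P n →
    Separated ε P →
    CardinalityAtMost tripleSetoid (Π α β P)
    (C * fromℕ n ^⟨ 4 / 3 , fromℕ-nonneg n ⟩ * ε ⁻¹⟨ 0<ε ⟩
    * log (ε ⁻¹⟨ 0<ε ⟩) (⁻¹-pos 0<ε)))
theorem2 R α β α≉0 β≉0 = constant R , threshold R , 0<constant R , 0<threshold R ,
  λ n threshold<n ε 0<ε P P⊆□ enumeration separated N hinges bound<N →
    ¬too-many-hinges R {n = n} {P = P} {N} bound<N (⁻¹-inverseˡ 0<ε) α≉0 β≉0 threshold<n
      P⊆□ enumeration separated hinges
  where open Plane R using (⁻¹-inverseˡ)
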